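{- $c(4)=4/3$ and $c(8)=332/315$.
   Context: For $n\ge\ell\ge3$, $C(n,\ell)$ is the maximum number of directed cycles of length $\ell$ in an $n$-vertex tournament, $R(n,\ell)=\frac{(\ell-1)!}{2^\ell}\binom n\ell$ is the expected number of such cycles in the uniformly random $n$-vertex tournament, and $c(\ell)=\lim_{n\to\infty}C(n,\ell)/R(n,\ell)$. -}

module Defs where

open import Data.Bool using (Bool; true; false; not; _∧_; if_then_else_)
open import Data.Nat using (ℕ; zero; suc; _≤_; _∸_; _^_; NonZero; _!)
import Data.Nat as ℕ
open import Data.Nat.DivMod using () renaming (_/_ to _div_)
open import Data.Nat.Properties using (m^n≢0)
open import Data.Nat.Combinatorics using (_C_)
open import Data.Fin using (Fin; _≟_)
open import Data.List using (List; []; _∷_; [_]; map; concatMap; allFin; length; filter)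
open import Data.Bool.ListAction using (any)
open import Data.Maybe using (Maybe; just; nothing)
open import Data.Integer using (+_)
open import Data.Rational using (ℚ; _<_; _*_; _-_; ∣_∣; 0ℚ)
import Data.Rational as ℚ
open import Data.Product using (Σ; ∃; _×_)
open import Relation.Nullary using (¬_)
open import Relation.Nullary.Decidable using (⌊_⌋)
open import Relation.Binary.PropositionalEquality using (_≡_)

record Tournament (n : ℕ) : Set where
  field
    arc    : Fin n → Fin n → Bool
    irrefl : ∀ i → arc i i ≡ false
    total  : ∀ i j → ¬ (i ≡ j) → arc i j ≡ not (arc j i)
open Tournament public

allSeqs : (n ℓ : ℕ) → List (List (Fin n))
allSeqs n zero    = [ [] ]
allSeqs n (suc ℓ) = concatMap (λ xs → map (λ x → x ∷ xs) (allFin n)) (allSeqs n ℓ)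

distinct : ∀ {n} → List (Fin n) → Bool
distinct []       = true
distinct (x ∷ xs) = not (any (λ y → ⌊ x ≟ y ⌋) xs) ∧ distinct xs

chain : ∀ {n} → Tournament n → List (Fin n) → Bool
chain T (x ∷ y ∷ xs) = arc T x y ∧ chain T (y ∷ xs)
chain T _            = true

lastArc : ∀ {n} → Tournament n → Fin n → List (Fin n) → Bool
lastArc T x₀ []           = true
lastArc T x₀ (x ∷ [])     = arc T x x₀
lastArc T x₀ (x ∷ y ∷ xs) = lastArc T x₀ (y ∷ xs)

closed : ∀ {n} → Tournament n → List (Fin n) → Bool
closed T []       = true
closed T (x ∷ xs) = chain T (x ∷ xs) ∧ lastArc T x (x ∷ xs)

isCycleSeq : ∀ {n} → Tournament n → List (Fin n) → Bool
isCycleSeq T xs = distinct xs ∧ closed T xs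

cycleSeqs : ∀ {n} → Tournament n → ℕ → ℕ
cycleSeqs {n} T ℓ = length (filter (λ xs → isCycleSeq T xs Data.Bool.≟ true) (allSeqs n ℓ))
  where import Data.Bool

-- number of directed cycles of length ℓ (as subgraphs): each cycle
-- corresponds to exactly ℓ cyclic sequences (its ℓ rotations)
numCycles : ∀ {n} → Tournament n → (ℓ : ℕ) → .{{NonZero ℓ}} → ℕ
numCycles T ℓ = cycleSeqs T ℓ div ℓ

IsMaxCycles : (n ℓ : ℕ) → .{{NonZero ℓ}} → ℕ → Set
IsMaxCycles n ℓ m = (Σ (Tournament n) λ T → numCycles T ℓ ≡ m) × (∀ (T : Tournament n) → numCycles T ℓ ≤ m)

R : ℕ → ℕ → ℚ
R n ℓ = (+ (((ℓ ∸ 1) !) ℕ.* (n C ℓ))) ℚ./ (2 ^ ℓ)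
  where instance _ = m^n≢0 2 ℓ

-- c(ℓ) = c: for the function C(·,ℓ), C(n,ℓ)/R(n,ℓ) → c as n → ∞
-- (stated without division: |C(n,ℓ) - c·R(n,ℓ)| < ε·R(n,ℓ), R(n,ℓ) > 0 for n ≥ ℓ)
LimitIs : (ℓ : ℕ) → .{{NonZero ℓ}} → ℚ → Set
LimitIs ℓ c =
  ∀ (C : ℕ → ℕ) → (∀ n → ℓ ≤ n → IsMaxCycles n ℓ (C n)) →
  ∀ (ε : ℚ) → 0ℚ < ε →
  ∃ λ (N : ℕ) → ∀ n → N ≤ n →
    ∣ (+ (C n)) ℚ./ 1 - c * R n ℓ ∣ < ε * R n ℓ

{-# OPTIONS --safe #-}
module Submission where

-- Let K be the skew ±1 matrix of a tournament on n vertices, J the all-ones matrix and u the all-ones vector. Up to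
-- O(nˡ⁻¹), 2ˡ times the number of cyclic sequences of length l is tr (J + K)ˡ. For l = 4 and 8 this falls short of
-- tr Kˡ + nˡ by a positive combination of squares, which is O(nˡ⁻¹) if the row sums K u are bounded.
--
-- The trace of Kˡ is a sum over tuples (v, x₁, …, xₗ₋₁) and may be averaged over the orderings of the xᵢ. Conjugating K
-- by the signs of its column at v turns the average into minus that of the signs of the orderings of a tournament on
-- the xᵢ, the sign being -1 to the number of backward arcs. The sum of these signs is least for the transitive
-- tournament, namely -2 over the 3! orderings for l = 4 and -272 over the 7! orderings for l = 8, so that
-- c(4) = 1 + 2/3! and c(8) = 1 + 272/7!. To find the minimum one may fix a Hamiltonian path, which exists by Rédei's
-- theorem, and minimise the polynomial in the signs of the other 15 arcs by substituting one sign at a time.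
-- Conjugating the transitive tournament by alternating signs keeps the row sums bounded and attains every bound.

open import Defs
open import Algebra.Bundles.Raw using (RawSemiring)
open import Algebra.Morphism.Structures using (module SemiringMorphisms)
open import Data.Bool as Bool using (Bool; true; false; not; _∧_; _∨_; _xor_; if_then_else_)
open import Data.Bool.ListAction using (any)
open import Data.Bool.Properties
  using (not-involutive; T-≡; ∧-assoc; xor-same; xor-comm; xor-identityʳ; xor-annihilates-not; not-distribʳ-xor)
open import Data.Bool.Solver using (module xor-∧-Solver)
open import Data.Fin as Fin using (Fin; zero; suc; toℕ)
import Data.Fin.Properties as Fin
open import Data.Integer as ℤ
  using (ℤ; +_; -[1+_]; +[1+_]; -_; _+_; _*_; _-_; _≤_; _^_; _⊓_; ∣_∣; 0ℤ; 1ℤ; -1ℤ; +≤+; -≤+)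
open import Data.Integer.Properties as ℤ using (+-*-semiring)
open import Algebra.Properties.Semiring.Sum +-*-semiring
  using (sum; sum-cong-≗; *-distribˡ-sum) renaming (∑-distrib-+ to sum-distrib-+; ∑-comm to sum-comm)
open import Data.Integer.Solver using (module +-*-Solver)
open import Data.Integer.Tactic.RingSolver using (solve-∀)
open import Data.List using (List; []; _∷_; _++_; length; map; concatMap; filter; allFin; lookup; tabulate)
import Data.List.Properties as List
open import Data.List.Membership.Propositional.Properties using (∈-lookup)
open import Data.List.Relation.Binary.Permutation.Propositional as ↭ using (_↭_; refl; prep; swap; ↭-sym; ↭-trans; ↭⇒↭ₛ)
open import Data.List.Relation.Binary.Permutation.Propositional.Properties using (↭-length; All-resp-↭)
import Data.List.Relation.Binary.Permutation.Setoid.Properties as ↭ₛ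
open import Data.List.Relation.Unary.All as All using (All; []; _∷_)
open import Data.List.Relation.Unary.AllPairs as AllPairs using (AllPairs; []; _∷_)
open import Data.List.Relation.Unary.Linked using (Linked; []; [-]; _∷_)
open import Data.List.Relation.Unary.Linked.Properties using (Linked⇒AllPairs)
open import Data.List.Relation.Unary.Unique.Propositional using (Unique)
open import Data.List.Relation.Unary.Unique.Propositional.Properties using (allFin⁺)
open import Data.Nat as ℕ using (ℕ; zero; suc; pred; NonZero; _!; _<ᵇ_)
open import Data.Nat.Combinatorics using (_C_; nCk≡nPk/k!)
open import Data.Nat.Combinatorics.Base as ℕ using (_P′_)
open import Data.Nat.Combinatorics.Specification using (nPk≡n!/[n∸k]!; nP′k≡n!/[n∸k]!; k!∣nP′k)
import Data.Nat.DivMod as ℕ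
import Data.Nat.Properties as ℕ
import Data.Nat.Tactic.RingSolver as ℕ
open import Data.Product using (_×_; _,_; proj₁; proj₂; ∃; map₂)
open import Data.Rational as ℚ using (ℚ; mkℚ; 0ℚ; toℚᵘ; _/_)
import Data.Rational.Properties as ℚ
open import Data.Rational.Unnormalised as ℚᵘ using (ℚᵘ; mkℚᵘ)
import Data.Rational.Unnormalised.Properties as ℚᵘ
open import Data.Sum using (_⊎_; inj₁; inj₂)
open import Data.Vec as Vec using (Vec; []; _∷_)
open import Data.Vec.Functional using (Vector)
import Data.Vec.Properties as Vec
open import Function using (id; _∘_; _on_; Equivalence)
open import Level using (0ℓ)
open import Relation.Binary using (Preorder; Symmetric; Transitive; tri<; tri≈; tri>)
open import Relation.Binary.Construct.Interior.Symmetric using (SymInterior; _,_; lhs≤rhs; symmetric)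
open import Relation.Binary.PropositionalEquality
import Relation.Binary.Reasoning.Preorder as PreorderReasoning
open import Relation.Nullary using (yes; no; contradiction)
open import Relation.Nullary.Decidable using (⌊_⌋)

private variable
  A B : Set
  m n : ℕ

*-nonNeg : ∀ {i j} → 0ℤ ≤ i → 0ℤ ≤ j → 0ℤ ≤ i * j
*-nonNeg {+ m} {+ n} _ _ = subst (0ℤ ≤_) (ℤ.pos-* m n) (+≤+ ℕ.z≤n)

*-mono-≤-nonNeg : ∀ {i j k l} → 0ℤ ≤ i → 0ℤ ≤ l → i ≤ j → k ≤ l → i * k ≤ j * l
*-mono-≤-nonNeg {i} {l = l} 0≤i 0≤l i≤j k≤l =
  ℤ.≤-trans (ℤ.*-monoˡ-≤-nonNeg i {{ℤ.nonNegative 0≤i}} k≤l) (ℤ.*-monoʳ-≤-nonNeg l {{ℤ.nonNegative 0≤l}} i≤j)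

pos-^ : ∀ m k → + (m ℕ.^ k) ≡ (+ m) ^ k
pos-^ m zero    = refl
pos-^ m (suc k) = trans (ℤ.pos-* m (m ℕ.^ k)) (cong (+ m *_) (pos-^ m k))

pos-^-nonNeg : ∀ m k → 0ℤ ≤ (+ m) ^ k
pos-^-nonNeg m k = subst (0ℤ ≤_) (pos-^ m k) (+≤+ ℕ.z≤n)

pos-*-^ : ∀ c m k → + (c ℕ.* m ℕ.^ k) ≡ + c * (+ m) ^ k
pos-*-^ c m k = trans (ℤ.pos-* c (m ℕ.^ k)) (cong (+ c *_) (pos-^ m k))

pos-^-mono-≤ : ∀ m {j k} → suc j ℕ.≤ k → (+ m) ^ suc j ≤ (+ m) ^ k
pos-^-mono-≤ zero    {k = k} _   = pos-^-nonNeg 0 k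
pos-^-mono-≤ (suc m) {j} {k} j<k = subst₂ _≤_ (pos-^ (suc m) (suc j)) (pos-^ (suc m) k) (+≤+ (ℕ.^-monoʳ-≤ (suc m) j<k))

i≤+∣i∣ : ∀ i → i ≤ + ∣ i ∣
i≤+∣i∣ (+ _)    = ℤ.≤-refl
i≤+∣i∣ -[1+ _ ] = -≤+

i≡-i⇒i≡0 : ∀ {i} → i ≡ - i → i ≡ 0ℤ
i≡-i⇒i≡0 {+ zero} _ = refl

0≤i² : ∀ i → 0ℤ ≤ i * i
0≤i² (+ m)    = *-nonNeg {+ m} {+ m} (+≤+ ℕ.z≤n) (+≤+ ℕ.z≤n)
0≤i² -[1+ _ ] = +≤+ ℕ.z≤n

i≤j+k⇒i-j≤k : ∀ {i j k} → i ≤ j + k → i - j ≤ k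
i≤j+k⇒i-j≤k {i} {j} {k} i≤j+k = subst (i - j ≤_) (cancel j k) (ℤ.+-monoˡ-≤ (- j) i≤j+k)
  where
  cancel : ∀ j k → j + k - j ≡ k
  cancel = solve-∀

∣i-j∣-≤ : ∀ {i j c} → i ≤ j + + c → j ≤ i + + c → ∣ i - j ∣ ℕ.≤ c
∣i-j∣-≤ {i} {j} {c} i≤j+c j≤i+c with ℤ.+∣i∣≡i⊎+∣i∣≡-i (i - j)
... | inj₁ ∣i-j∣≡i-j = ℤ.drop‿+≤+ (subst (_≤ + c) (sym ∣i-j∣≡i-j) (i≤j+k⇒i-j≤k i≤j+c))
... | inj₂ ∣i-j∣≡j-i = ℤ.drop‿+≤+ (subst (_≤ + c) (sym (trans ∣i-j∣≡j-i (flip i j))) (i≤j+k⇒i-j≤k j≤i+c))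
  where
  flip : ∀ i j → - (i - j) ≡ j - i
  flip = solve-∀

-- Sums over vertices and over tuples of vertices

sum-mono-≤ : {f g : Vector ℤ n} → (∀ i → f i ≤ g i) → sum f ≤ sum g
sum-mono-≤ {zero}  f≤g = ℤ.≤-refl
sum-mono-≤ {suc n} f≤g = ℤ.+-mono-≤ (f≤g zero) (sum-mono-≤ (f≤g ∘ suc))

sum-const : ∀ n c → sum {n} (λ _ → c) ≡ + n * c
sum-const zero    c = refl
sum-const (suc n) c = trans (cong (λ S → c + S) (sum-const n c)) (sym (ℤ.suc-* (+ n) c))

∣sum∣-≤ : ∀ {c} {f : Vector ℤ n} → (∀ i → ∣ f i ∣ ℕ.≤ c) → ∣ sum f ∣ ℕ.≤ n ℕ.* c
∣sum∣-≤ {zero}          ∣f∣≤c = ℕ.z≤n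
∣sum∣-≤ {suc n} {f = f} ∣f∣≤c = ℕ.≤-trans (ℤ.∣i+j∣≤∣i∣+∣j∣ (f zero) _) (ℕ.+-mono-≤ (∣f∣≤c zero) (∣sum∣-≤ (∣f∣≤c ∘ suc)))

module Sums (n : ℕ) where

  ∑ : Vector ℤ n → ℤ
  ∑ = sum

  ∑-cong : ∀ {f g} → f ≗ g → ∑ f ≡ ∑ g
  ∑-cong = sum-cong-≗

  ∑-mono-≤ : ∀ {f g} → (∀ i → f i ≤ g i) → ∑ f ≤ ∑ g
  ∑-mono-≤ = sum-mono-≤

  ∣∑∣-≤ : ∀ {c f} → (∀ i → ∣ f i ∣ ℕ.≤ c) → ∣ ∑ f ∣ ℕ.≤ n ℕ.* c
  ∣∑∣-≤ = ∣sum∣-≤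

  ∑-distrib-+ : ∀ f g → ∑ (λ i → f i + g i) ≡ ∑ f + ∑ g
  ∑-distrib-+ = sum-distrib-+

  *-distribˡ-∑ : ∀ c f → c * ∑ f ≡ ∑ (λ i → c * f i)
  *-distribˡ-∑ = *-distribˡ-sum

  ∑-comm : ∀ (f : Fin n → Vector ℤ n) → ∑ (λ i → ∑ (f i)) ≡ ∑ (λ j → ∑ λ i → f i j)
  ∑-comm = sum-comm

  ∑-const : ∀ c → ∑ (λ _ → c) ≡ + n * c
  ∑-const = sum-const n

  ∑-zero : ∑ (λ _ → 0ℤ) ≡ 0ℤ
  ∑-zero = trans (∑-const 0ℤ) (ℤ.*-zeroʳ (+ n))

  ∑-tuples : ℕ → (List (Fin n) → ℤ) → ℤ
  ∑-tuples zero    F = F []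
  ∑-tuples (suc k) F = ∑ λ x → ∑-tuples k λ xs → F (x ∷ xs)

  ∑-tuples-mono-≤ : ∀ k {F G} → (∀ xs → length xs ≡ k → F xs ≤ G xs) → ∑-tuples k F ≤ ∑-tuples k G
  ∑-tuples-mono-≤ zero    F≤G = F≤G [] refl
  ∑-tuples-mono-≤ (suc k) F≤G = ∑-mono-≤ λ x → ∑-tuples-mono-≤ k λ xs |xs|≡k → F≤G (x ∷ xs) (cong suc |xs|≡k)

  ∑-tuples-distrib-+ : ∀ k F G → ∑-tuples k (λ xs → F xs + G xs) ≡ ∑-tuples k F + ∑-tuples k G
  ∑-tuples-distrib-+ zero    F G = refl
  ∑-tuples-distrib-+ (suc k) F G = trans (∑-cong λ x → ∑-tuples-distrib-+ k (F ∘ (x ∷_)) (G ∘ (x ∷_))) (∑-distrib-+ _ _)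

  *-distribˡ-∑-tuples : ∀ k c F → c * ∑-tuples k F ≡ ∑-tuples k (λ xs → c * F xs)
  *-distribˡ-∑-tuples zero    c F = refl
  *-distribˡ-∑-tuples (suc k) c F = trans (*-distribˡ-∑ c _) (∑-cong λ x → *-distribˡ-∑-tuples k c (F ∘ (x ∷_)))

  ∑-tuples-∑-comm : ∀ k (F : Fin n → List (Fin n) → ℤ) → ∑-tuples k (λ xs → ∑ λ i → F i xs) ≡ ∑ λ i → ∑-tuples k (F i)
  ∑-tuples-∑-comm zero    F = refl
  ∑-tuples-∑-comm (suc k) F = trans (∑-cong λ x → ∑-tuples-∑-comm k λ i → F i ∘ (x ∷_)) (∑-comm _)

  ∑-tuples-const : ∀ k c → ∑-tuples k (λ _ → c) ≡ (+ n) ^ k * c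
  ∑-tuples-const zero    c = sym (ℤ.*-identityˡ c)
  ∑-tuples-const (suc k) c = begin
    ∑ (λ _ → ∑-tuples k λ _ → c)  ≡⟨ ∑-cong (λ _ → ∑-tuples-const k c) ⟩
    ∑ (λ _ → (+ n) ^ k * c)       ≡⟨ ∑-const _ ⟩
    + n * ((+ n) ^ k * c)         ≡⟨ ℤ.*-assoc (+ n) ((+ n) ^ k) c ⟨
    (+ n) ^ suc k * c             ∎
    where open ≡-Reasoning

-- Tuples with repeated entries

indicator : Bool → ℤ
indicator b = if b then 1ℤ else 0ℤ

indicator-nonNeg : ∀ b → 0ℤ ≤ indicator b
indicator-nonNeg true  = +≤+ ℕ.z≤n
indicator-nonNeg false = +≤+ ℕ.z≤n

indicator-∧ : ∀ a b → indicator (a ∧ b) ≡ indicator a * indicator b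
indicator-∧ true  b = sym (ℤ.*-identityˡ (indicator b))
indicator-∧ false b = sym (ℤ.*-zeroˡ (indicator b))

indicator-∨-≤ : ∀ a b → indicator (a ∨ b) ≤ indicator a + indicator b
indicator-∨-≤ true  b = ℤ.+-monoʳ-≤ 1ℤ (indicator-nonNeg b)
indicator-∨-≤ false b = ℤ.≤-reflexive (sym (ℤ.+-identityˡ (indicator b)))

_∈ᵇ_ : Fin n → List (Fin n) → Bool
x ∈ᵇ xs = any (λ y → ⌊ x Fin.≟ y ⌋) xs

sum-indicator-≟ : (y : Fin n) → sum (λ x → indicator ⌊ x Fin.≟ y ⌋) ≡ 1ℤ
sum-indicator-≟ {suc n} zero    = cong (λ S → 1ℤ + S) (Sums.∑-zero n)
sum-indicator-≟ {suc n} (suc y) = trans (ℤ.+-identityˡ _) (trans (sum-cong-≗ suc-≟) (sum-indicator-≟ y))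
  where
  suc-≟ : ∀ x → indicator ⌊ suc x Fin.≟ suc y ⌋ ≡ indicator ⌊ x Fin.≟ y ⌋
  suc-≟ x with x Fin.≟ y
  ... | yes _ = refl
  ... | no  _ = refl

triangular : ℕ → ℕ
triangular zero    = 0
triangular (suc k) = k ℕ.+ triangular k

module Repetitions (n : ℕ) where
  open Sums n

  ∑-indicator-∈ᵇ : ∀ xs → ∑ (λ x → indicator (x ∈ᵇ xs)) ≤ + length xs
  ∑-indicator-∈ᵇ []       = ℤ.≤-reflexive ∑-zero
  ∑-indicator-∈ᵇ (y ∷ xs) = begin
    ∑ (λ x → indicator (⌊ x Fin.≟ y ⌋ ∨ x ∈ᵇ xs))
      ≤⟨ ∑-mono-≤ (λ x → indicator-∨-≤ ⌊ x Fin.≟ y ⌋ (x ∈ᵇ xs)) ⟩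
    ∑ (λ x → indicator ⌊ x Fin.≟ y ⌋ + indicator (x ∈ᵇ xs))
      ≡⟨ ∑-distrib-+ _ _ ⟩
    ∑ (λ x → indicator ⌊ x Fin.≟ y ⌋) + ∑ (λ x → indicator (x ∈ᵇ xs))
      ≤⟨ ℤ.+-mono-≤ (ℤ.≤-reflexive (sum-indicator-≟ y)) (∑-indicator-∈ᵇ xs) ⟩
    + suc (length xs) ∎
    where open ℤ.≤-Reasoning

  repeats : List (Fin n) → ℤ
  repeats xs = indicator (not (distinct xs))

  repeats-∷-≤ : ∀ x xs → repeats (x ∷ xs) ≤ indicator (x ∈ᵇ xs) + repeats xs
  repeats-∷-≤ x xs = ℤ.≤-trans (ℤ.≤-reflexive (cong indicator (not-not-∧ (x ∈ᵇ xs) (distinct xs))))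
    (indicator-∨-≤ (x ∈ᵇ xs) (not (distinct xs)))
    where
    not-not-∧ : ∀ a b → not (not a ∧ b) ≡ a ∨ not b
    not-not-∧ true  b = refl
    not-not-∧ false b = refl

  ∑-tuples-repeats : ∀ k → ∑-tuples (suc k) repeats ≤ + triangular (suc k) * (+ n) ^ k
  ∑-tuples-repeats zero    = ℤ.≤-reflexive ∑-zero
  ∑-tuples-repeats (suc k) = begin
    ∑ (λ x → ∑-tuples (suc k) λ xs → repeats (x ∷ xs))
      ≤⟨ ∑-mono-≤ (λ x → ∑-tuples-mono-≤ (suc k) λ xs _ → repeats-∷-≤ x xs) ⟩
    ∑ (λ x → ∑-tuples (suc k) λ xs → indicator (x ∈ᵇ xs) + repeats xs)
      ≡⟨ ∑-cong (λ x → ∑-tuples-distrib-+ (suc k) (λ xs → indicator (x ∈ᵇ xs)) repeats) ⟩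
    ∑ (λ x → ∑-tuples (suc k) (λ xs → indicator (x ∈ᵇ xs)) + ∑-tuples (suc k) repeats)
      ≡⟨ ∑-distrib-+ _ _ ⟩
    ∑ (λ x → ∑-tuples (suc k) λ xs → indicator (x ∈ᵇ xs)) + ∑ (λ _ → ∑-tuples (suc k) repeats)
      ≡⟨ cong₂ _+_ (sym (∑-tuples-∑-comm (suc k) λ x xs → indicator (x ∈ᵇ xs))) (∑-const _) ⟩
    ∑-tuples (suc k) (λ xs → ∑ λ x → indicator (x ∈ᵇ xs)) + + n * ∑-tuples (suc k) repeats
      ≤⟨ ℤ.+-mono-≤ (∑-tuples-mono-≤ (suc k) ∑-members-≤) (ℤ.*-monoˡ-≤-nonNeg (+ n) (∑-tuples-repeats k)) ⟩
    ∑-tuples (suc k) (λ _ → + suc k) + + n * (+ triangular (suc k) * (+ n) ^ k)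
      ≡⟨ cong (_+ + n * (+ triangular (suc k) * (+ n) ^ k)) (∑-tuples-const (suc k) (+ suc k)) ⟩
    (+ n) ^ suc k * + suc k + + n * (+ triangular (suc k) * (+ n) ^ k)
      ≡⟨ collect (+ n) ((+ n) ^ k) (+ suc k) (+ triangular (suc k)) ⟩
    + triangular (suc (suc k)) * (+ n) ^ suc k ∎
    where
    open ℤ.≤-Reasoning
    ∑-members-≤ : ∀ xs → length xs ≡ suc k → ∑ (λ x → indicator (x ∈ᵇ xs)) ≤ + suc k
    ∑-members-≤ xs |xs| = subst (λ l → ∑ (λ x → indicator (x ∈ᵇ xs)) ≤ + l) |xs| (∑-indicator-∈ᵇ xs)
    collect : ∀ n p a b → n * p * a + n * (b * p) ≡ (a + b) * (n * p)
    collect = solve-∀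

  ∑-tuples-mono-≤-distinct : ∀ k c {F G} →
    (∀ xs → length xs ≡ suc k → F xs ≤ G xs + + c) →
    (∀ xs → length xs ≡ suc k → distinct xs ≡ true → F xs ≤ G xs) →
    ∑-tuples (suc k) F ≤ ∑-tuples (suc k) G + + (c ℕ.* triangular (suc k)) * (+ n) ^ k
  ∑-tuples-mono-≤-distinct k c {F} {G} F≤G+c F≤G = begin
    ∑-tuples (suc k) F
      ≤⟨ ∑-tuples-mono-≤ (suc k) pointwise ⟩
    ∑-tuples (suc k) (λ xs → G xs + + c * repeats xs)
      ≡⟨ ∑-tuples-distrib-+ (suc k) G (λ xs → + c * repeats xs) ⟩
    ∑G + ∑-tuples (suc k) (λ xs → + c * repeats xs)
      ≡⟨ cong (λ S → ∑G + S) (*-distribˡ-∑-tuples (suc k) (+ c) repeats) ⟨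
    ∑G + + c * ∑-tuples (suc k) repeats
      ≤⟨ ℤ.+-monoʳ-≤ ∑G (ℤ.*-monoˡ-≤-nonNeg (+ c) (∑-tuples-repeats k)) ⟩
    ∑G + + c * (+ triangular (suc k) * (+ n) ^ k)
      ≡⟨ cong (λ S → ∑G + S) (ℤ.*-assoc (+ c) (+ triangular (suc k)) _) ⟨
    ∑G + + c * + triangular (suc k) * (+ n) ^ k
      ≡⟨ cong (λ C → ∑G + C * (+ n) ^ k) (ℤ.pos-* c (triangular (suc k))) ⟨
    ∑G + + (c ℕ.* triangular (suc k)) * (+ n) ^ k ∎
    where
    open ℤ.≤-Reasoning
    ∑G : ℤ
    ∑G = ∑-tuples (suc k) G
    pointwise : ∀ xs → length xs ≡ suc k → F xs ≤ G xs + + c * repeats xs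
    pointwise xs |xs| with distinct xs in eq
    ... | false = subst (λ d → F xs ≤ G xs + d) (sym (ℤ.*-identityʳ (+ c))) (F≤G+c xs |xs|)
    ... | true  = begin
      F xs             ≤⟨ F≤G xs |xs| eq ⟩
      G xs             ≡⟨ ℤ.+-identityʳ (G xs) ⟨
      G xs + 0ℤ        ≡⟨ cong (λ d → G xs + d) (ℤ.*-zeroʳ (+ c)) ⟨
      G xs + + c * 0ℤ  ∎

distinct⇒Unique : (xs : List (Fin n)) → distinct xs ≡ true → Unique xs
distinct⇒Unique []       _ = []
distinct⇒Unique (x ∷ xs) d with x ∈ᵇ xs in eq
... | false = ∉ᵇ⇒All-≢ xs eq ∷ distinct⇒Unique xs d
  where
  ∉ᵇ⇒All-≢ : ∀ ys → x ∈ᵇ ys ≡ false → All (x ≢_) ys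
  ∉ᵇ⇒All-≢ []       _ = []
  ∉ᵇ⇒All-≢ (y ∷ ys) e with x Fin.≟ y
  ... | no x≢y = x≢y ∷ ∉ᵇ⇒All-≢ ys e

-- Sums over the orderings of a list

module PathSums (R : RawSemiring 0ℓ 0ℓ) where
  open RawSemiring R renaming (_+_ to _⊕_; _*_ to _⊗_)

  ∑-pick : (A → List A → Carrier) → List A → Carrier
  ∑-pick f []       = 0#
  ∑-pick f (x ∷ xs) = f x xs ⊕ ∑-pick (λ y rest → f y (x ∷ rest)) xs

  -- The sum of s v x₁ ⊗ s x₁ x₂ ⊗ ⋯ ⊗ s xₖ₋₁ xₖ ⊗ g xₖ over the orderings x₁, …, xₖ of a list of length k.
  paths : (A → A → Carrier) → (A → Carrier) → ℕ → A → List A → Carrier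
  paths s g zero    v _  = g v
  paths s g (suc k) v xs = ∑-pick (λ x rest → s v x ⊗ paths s g k x rest) xs

  hamPaths : (A → A → Carrier) → ℕ → List A → Carrier
  hamPaths s k = ∑-pick (paths s (λ _ → 1#) k)

  ∑-pick-cong : ∀ {f g : A → List A → Carrier} xs → (∀ x rest → x ∷ rest ↭ xs → f x rest ≡ g x rest) →
    ∑-pick f xs ≡ ∑-pick g xs
  ∑-pick-cong []       _   = refl
  ∑-pick-cong (x ∷ xs) f≗g = cong₂ _⊕_ (f≗g x xs refl)
    (∑-pick-cong xs λ y rest p → f≗g y (x ∷ rest) (↭-trans (swap y x refl) (prep x p)))

  ∑-pick-map : ∀ (h : A → B) (f : B → List B → Carrier) xs →
    ∑-pick f (map h xs) ≡ ∑-pick (λ x rest → f (h x) (map h rest)) xs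
  ∑-pick-map h f []       = refl
  ∑-pick-map h f (x ∷ xs) = cong (λ S → f (h x) (map h xs) ⊕ S) (∑-pick-map h (λ y rest → f y (h x ∷ rest)) xs)

  paths-map : ∀ (h : A → B) s g k v xs → paths s g k (h v) (map h xs) ≡ paths (s on h) (g ∘ h) k v xs
  paths-map h s g zero    v xs = refl
  paths-map h s g (suc k) v xs = trans (∑-pick-map h _ xs)
    (∑-pick-cong xs λ x rest _ → cong (λ P → s (h v) (h x) ⊗ P) (paths-map h s g k x rest))

  hamPaths-map : ∀ (h : A → B) s k xs → hamPaths s k (map h xs) ≡ hamPaths (s on h) k xs
  hamPaths-map h s k xs = trans (∑-pick-map h _ xs) (∑-pick-cong xs λ x rest _ → paths-map h s _ k x rest)

open PathSums ℤ.+-*-rawSemiring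

module _ {R : RawSemiring 0ℓ 0ℓ} {⟦_⟧ : RawSemiring.Carrier R → ℤ}
  (⟦⟧-homo : SemiringMorphisms.IsSemiringHomomorphism R ℤ.+-*-rawSemiring ⟦_⟧) where
  open RawSemiring R using (Carrier; 1#)
  open SemiringMorphisms.IsSemiringHomomorphism ⟦⟧-homo using (+-homo; *-homo; 0#-homo; 1#-homo)
  private module R = PathSums R

  ∑-pick-homo : ∀ (f : A → List A → Carrier) xs → ⟦ R.∑-pick f xs ⟧ ≡ ∑-pick (λ x rest → ⟦ f x rest ⟧) xs
  ∑-pick-homo f []       = 0#-homo
  ∑-pick-homo f (x ∷ xs) = trans (+-homo _ _) (cong (λ S → ⟦ f x xs ⟧ + S) (∑-pick-homo _ xs))

  paths-homo : ∀ (s : A → A → Carrier) g k v xs → ⟦ R.paths s g k v xs ⟧ ≡ paths (λ x y → ⟦ s x y ⟧) (⟦_⟧ ∘ g) k v xs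
  paths-homo s g zero    v xs = refl
  paths-homo s g (suc k) v xs = trans (∑-pick-homo _ xs)
    (∑-pick-cong xs λ x rest _ → trans (*-homo _ _) (cong (λ P → ⟦ s v x ⟧ * P) (paths-homo s g k x rest)))

  hamPaths-homo : ∀ (s : A → A → Carrier) k xs → ⟦ R.hamPaths s k xs ⟧ ≡ hamPaths (λ x y → ⟦ s x y ⟧) k xs
  hamPaths-homo s k xs = trans (∑-pick-homo _ xs)
    (∑-pick-cong xs λ x rest _ → trans (paths-homo s (λ _ → 1#) k x rest)
      (cong (λ c → paths (λ x y → ⟦ s x y ⟧) (λ _ → c) k x rest) 1#-homo))

∑-pick-↭ : ∀ {f : A → List A → ℤ} → (∀ x {rest rest′} → rest ↭ rest′ → f x rest ≡ f x rest′) →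
  ∀ {xs ys} → xs ↭ ys → ∑-pick f xs ≡ ∑-pick f ys
∑-pick-↭ f-↭ refl          = refl
∑-pick-↭ f-↭ (↭.trans p q) = trans (∑-pick-↭ f-↭ p) (∑-pick-↭ f-↭ q)
∑-pick-↭ f-↭ (prep x p)    = cong₂ _+_ (f-↭ x p) (∑-pick-↭ (λ y q → f-↭ y (prep x q)) p)
∑-pick-↭ {f = f} f-↭ (swap {xs} {ys} x y p) = begin
  f x (y ∷ xs) + (f y (x ∷ xs) + ∑-pick (λ z rest → f z (x ∷ y ∷ rest)) xs)
    ≡⟨ cong₂ _+_ (f-↭ x (prep y p)) (cong₂ _+_ (f-↭ y (prep x p)) others) ⟩
  f x (y ∷ ys) + (f y (x ∷ ys) + ∑-pick (λ z rest → f z (y ∷ x ∷ rest)) ys)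
    ≡⟨ exchange (f x (y ∷ ys)) (f y (x ∷ ys)) _ ⟩
  f y (x ∷ ys) + (f x (y ∷ ys) + ∑-pick (λ z rest → f z (y ∷ x ∷ rest)) ys) ∎
  where
  open ≡-Reasoning
  others : ∑-pick (λ z rest → f z (x ∷ y ∷ rest)) xs ≡ ∑-pick (λ z rest → f z (y ∷ x ∷ rest)) ys
  others = trans (∑-pick-↭ (λ z q → f-↭ z (prep x (prep y q))) p) (∑-pick-cong ys λ z _ _ → f-↭ z (swap x y refl))
  exchange : ∀ a b c → a + (b + c) ≡ b + (a + c)
  exchange = solve-∀

paths-↭ : ∀ (s : A → A → ℤ) g k v {xs ys} → xs ↭ ys → paths s g k v xs ≡ paths s g k v ys
paths-↭ s g zero    v p = refl
paths-↭ s g (suc k) v p = ∑-pick-↭ (λ x q → cong (s v x *_) (paths-↭ s g k x q)) p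

hamPaths-↭ : ∀ (s : A → A → ℤ) k {xs ys} → xs ↭ ys → hamPaths s k xs ≡ hamPaths s k ys
hamPaths-↭ s k = ∑-pick-↭ (paths-↭ s (λ _ → 1ℤ) k)

*-distribˡ-∑-pick : ∀ c (f : A → List A → ℤ) xs → c * ∑-pick f xs ≡ ∑-pick (λ x rest → c * f x rest) xs
*-distribˡ-∑-pick c f []       = ℤ.*-zeroʳ c
*-distribˡ-∑-pick c f (x ∷ xs) =
  trans (ℤ.*-distribˡ-+ c (f x xs) _) (cong (λ S → c * f x xs + S) (*-distribˡ-∑-pick c _ xs))

∣∑-pick∣-≤ : ∀ {k c} {f : A → List A → ℤ} xs → length xs ≡ k → (∀ x rest → x ∷ rest ↭ xs → ∣ f x rest ∣ ℕ.≤ c) →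
  ∣ ∑-pick f xs ∣ ℕ.≤ k ℕ.* c
∣∑-pick∣-≤         []       refl _     = ℕ.z≤n
∣∑-pick∣-≤ {f = f} (x ∷ xs) refl ∣f∣≤c = ℕ.≤-trans (ℤ.∣i+j∣≤∣i∣+∣j∣ (f x xs) _) (ℕ.+-mono-≤ (∣f∣≤c x xs refl)
  (∣∑-pick∣-≤ xs refl λ y rest p → ∣f∣≤c y (x ∷ rest) (↭-trans (swap y x refl) (prep x p))))

∣paths∣-≤ : ∀ {s : A → A → ℤ} {g} → (∀ x y → ∣ s x y ∣ ℕ.≤ 1) → (∀ x → ∣ g x ∣ ℕ.≤ 1) →
  ∀ k v xs → length xs ≡ k → ∣ paths s g k v xs ∣ ℕ.≤ k !
∣paths∣-≤             ∣s∣≤1 ∣g∣≤1 zero    v xs _    = ∣g∣≤1 v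
∣paths∣-≤ {s = s} {g} ∣s∣≤1 ∣g∣≤1 (suc k) v xs |xs| = ∣∑-pick∣-≤ xs |xs| λ x rest p → begin
  ∣ s v x * paths s g k x rest ∣        ≡⟨ ℤ.abs-* (s v x) _ ⟩
  ∣ s v x ∣ ℕ.* ∣ paths s g k x rest ∣  ≤⟨ ℕ.*-mono-≤ (∣s∣≤1 v x) (∣paths∣-≤ ∣s∣≤1 ∣g∣≤1 k x rest
                                             (ℕ.suc-injective (trans (↭-length p) |xs|))) ⟩
  1 ℕ.* k !                             ≡⟨ ℕ.*-identityˡ (k !) ⟩
  k !                                   ∎
  where open ℕ.≤-Reasoning

module _ (n : ℕ) where
  open Sums n

  ∑-tuples-pick : ∀ k (f : Fin n → List (Fin n) → ℤ) → ∑-tuples (suc k) (∑-pick f) ≡ + suc k * ∑ λ x → ∑-tuples k (f x)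
  ∑-tuples-pick k f = begin
    ∑ (λ x → ∑-tuples k λ xs → f x xs + ∑-pick (λ y rest → f y (x ∷ rest)) xs)
      ≡⟨ ∑-cong (λ x → ∑-tuples-distrib-+ k (f x) _) ⟩
    ∑ (λ x → ∑-tuples k (f x) + ∑-tuples k (∑-pick λ y rest → f y (x ∷ rest)))
      ≡⟨ ∑-distrib-+ _ _ ⟩
    ∑f + ∑ (λ x → ∑-tuples k (∑-pick λ y rest → f y (x ∷ rest)))
      ≡⟨ cong (λ S → ∑f + S) (later k) ⟩
    ∑f + + k * ∑f
      ≡⟨ ℤ.suc-* (+ k) ∑f ⟨
    + suc k * ∑f ∎
    where
    open ≡-Reasoning
    ∑f : ℤ
    ∑f = ∑ λ x → ∑-tuples k (f x)
    later : ∀ k → ∑ (λ x → ∑-tuples k (∑-pick λ y rest → f y (x ∷ rest))) ≡ + k * ∑ λ x → ∑-tuples k (f x)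
    later zero    = ∑-zero
    later (suc k) = begin
      ∑ (λ x → ∑-tuples (suc k) (∑-pick λ y rest → f y (x ∷ rest)))
        ≡⟨ ∑-cong (λ x → ∑-tuples-pick k λ y rest → f y (x ∷ rest)) ⟩
      ∑ (λ x → + suc k * ∑ (λ y → ∑-tuples k λ rest → f y (x ∷ rest)))
        ≡⟨ *-distribˡ-∑ (+ suc k) _ ⟨
      + suc k * ∑ (λ x → ∑ λ y → ∑-tuples k λ rest → f y (x ∷ rest))
        ≡⟨ cong (+ suc k *_) (∑-comm λ x y → ∑-tuples k λ rest → f y (x ∷ rest)) ⟩
      + suc k * ∑ (λ y → ∑-tuples (suc k) (f y)) ∎

AllPairs-resp-↭ : ∀ {R : A → A → Set} → Symmetric R → ∀ {xs ys} → xs ↭ ys → AllPairs R xs → AllPairs R ys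
AllPairs-resp-↭ {R = R} R-sym p = ↭ₛ.AllPairs-resp-↭ (setoid _) R-sym (resp₂ R) (↭⇒↭ₛ p)

module _ {s s′ : A → A → ℤ} (g : A → ℤ) where

  Switched : A → A → Set
  Switched = SymInterior λ x y → s x y * g y ≡ g x * s′ x y

  paths-switch : ∀ k v xs → AllPairs Switched (v ∷ xs) → paths s g k v xs ≡ g v * paths s′ (λ _ → 1ℤ) k v xs
  paths-switch zero    v xs _          = sym (ℤ.*-identityʳ (g v))
  paths-switch (suc k) v xs (vs ∷ sws) = trans (∑-pick-cong xs step) (sym (*-distribˡ-∑-pick (g v) _ xs))
    where
    step : ∀ x rest → x ∷ rest ↭ xs → s v x * paths s g k x rest ≡ g v * (s′ v x * paths s′ (λ _ → 1ℤ) k x rest)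
    step x rest p = begin
      s v x * paths s g k x rest  ≡⟨ cong (s v x *_) (paths-switch k x rest (AllPairs-resp-↭ symmetric (↭-sym p) sws)) ⟩
      s v x * (g x * P)           ≡⟨ ℤ.*-assoc (s v x) (g x) P ⟨
      s v x * g x * P             ≡⟨ cong (_* P) (lhs≤rhs (All.head (All-resp-↭ (↭-sym p) vs))) ⟩
      g v * s′ v x * P            ≡⟨ ℤ.*-assoc (g v) (s′ v x) P ⟩
      g v * (s′ v x * P)          ∎
      where
      open ≡-Reasoning
      P : ℤ
      P = paths s′ (λ _ → 1ℤ) k x rest

hamPaths-cong : ∀ {s s′ : A → A → ℤ} k xs → AllPairs (SymInterior λ x y → s x y ≡ s′ x y) xs →
  hamPaths s k xs ≡ hamPaths s′ k xs
hamPaths-cong k xs s≡s′ = ∑-pick-cong xs λ x rest p → trans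
  (paths-switch (λ _ → 1ℤ) k x rest
    (AllPairs.map (λ (xy , yx) → unit xy , unit yx) (AllPairs-resp-↭ symmetric (↭-sym p) s≡s′)))
  (ℤ.*-identityˡ _)
  where
  unit : ∀ {i j} → i ≡ j → i * 1ℤ ≡ 1ℤ * j
  unit refl = ℤ.*-comm _ 1ℤ

-- Signs

sign : Bool → ℤ
sign true  = 1ℤ
sign false = -1ℤ

sign-not : ∀ b → sign (not b) ≡ - sign b
sign-not true  = refl
sign-not false = refl

sign-square : ∀ b → sign b * sign b ≡ 1ℤ
sign-square true  = refl
sign-square false = refl

sign-xor : ∀ a b → sign (a xor b) ≡ - (sign a * sign b)
sign-xor true  b = trans (sign-not b) (cong -_ (sym (ℤ.*-identityˡ (sign b))))
sign-xor false true  = refl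
sign-xor false false = refl

-- Integer polynomials in n signs, that is, modulo the relations x² = 1.
data Poly : ℕ → Set where
  𝟘     : Poly n
  con   : ℤ → Poly 0
  _+x*_ : Poly n → Poly n → Poly (suc n)

eval : Vec Bool n → Poly n → ℤ
eval ρ       𝟘         = 0ℤ
eval ρ       (con c)   = c
eval (b ∷ ρ) (p +x* q) = eval ρ p + sign b * eval ρ q

const : ∀ n → ℤ → Poly n
const zero    c = con c
const (suc n) c = const n c +x* 𝟘

eval-const : ∀ (ρ : Vec Bool n) c → eval ρ (const n c) ≡ c
eval-const []      c = refl
eval-const (b ∷ ρ) c = trans (cong₂ _+_ (eval-const ρ c) (ℤ.*-zeroʳ (sign b))) (ℤ.+-identityʳ c)

infixl 6 _+ᴾ_
infixl 7 _*ᴾ_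
infix  8 -ᴾ_

_+ᴾ_ : Poly n → Poly n → Poly n
𝟘             +ᴾ q           = q
p@(con _)     +ᴾ 𝟘           = p
con c         +ᴾ con d       = con (c + d)
p@(_ +x* _)   +ᴾ 𝟘           = p
(p₀ +x* p₁)   +ᴾ (q₀ +x* q₁) = (p₀ +ᴾ q₀) +x* (p₁ +ᴾ q₁)

-ᴾ_ : Poly n → Poly n
-ᴾ 𝟘         = 𝟘
-ᴾ con c     = con (- c)
-ᴾ (p +x* q) = (-ᴾ p) +x* (-ᴾ q)

_*ᴾ_ : Poly n → Poly n → Poly n
𝟘           *ᴾ q           = 𝟘
con _       *ᴾ 𝟘           = 𝟘
con c       *ᴾ con d       = con (c * d)
(_ +x* _)   *ᴾ 𝟘           = 𝟘
(p₀ +x* p₁) *ᴾ (q₀ +x* q₁) = (p₀ *ᴾ q₀ +ᴾ p₁ *ᴾ q₁) +x* (p₀ *ᴾ q₁ +ᴾ p₁ *ᴾ q₀)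

module _ where
  open ≡-Reasoning

  eval-+ᴾ : ∀ (ρ : Vec Bool n) p q → eval ρ (p +ᴾ q) ≡ eval ρ p + eval ρ q
  eval-+ᴾ ρ  𝟘         q       = sym (ℤ.+-identityˡ (eval ρ q))
  eval-+ᴾ [] (con c)   𝟘       = sym (ℤ.+-identityʳ c)
  eval-+ᴾ [] (con c)   (con d) = refl
  eval-+ᴾ ρ@(_ ∷ _) p@(_ +x* _) 𝟘 = sym (ℤ.+-identityʳ (eval ρ p))
  eval-+ᴾ (b ∷ ρ) (p₀ +x* p₁) (q₀ +x* q₁) = begin
    eval ρ (p₀ +ᴾ q₀) + sign b * eval ρ (p₁ +ᴾ q₁)
      ≡⟨ cong₂ (λ i j → i + sign b * j) (eval-+ᴾ ρ p₀ q₀) (eval-+ᴾ ρ p₁ q₁) ⟩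
    (eval ρ p₀ + eval ρ q₀) + sign b * (eval ρ p₁ + eval ρ q₁)
      ≡⟨ regroup (eval ρ p₀) (eval ρ q₀) (sign b) (eval ρ p₁) (eval ρ q₁) ⟩
    (eval ρ p₀ + sign b * eval ρ p₁) + (eval ρ q₀ + sign b * eval ρ q₁) ∎
    where
    regroup : ∀ p₀ q₀ s p₁ q₁ → (p₀ + q₀) + s * (p₁ + q₁) ≡ (p₀ + s * p₁) + (q₀ + s * q₁)
    regroup = solve-∀

  eval--ᴾ : ∀ (ρ : Vec Bool n) p → eval ρ (-ᴾ p) ≡ - eval ρ p
  eval--ᴾ ρ       𝟘         = refl
  eval--ᴾ []      (con c)   = refl
  eval--ᴾ (b ∷ ρ) (p +x* q) = begin
    eval ρ (-ᴾ p) + sign b * eval ρ (-ᴾ q)  ≡⟨ cong₂ (λ i j → i + sign b * j) (eval--ᴾ ρ p) (eval--ᴾ ρ q) ⟩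
    - eval ρ p + sign b * - eval ρ q        ≡⟨ regroup (eval ρ p) (sign b) (eval ρ q) ⟩
    - (eval ρ p + sign b * eval ρ q)        ∎
    where
    regroup : ∀ p s q → - p + s * - q ≡ - (p + s * q)
    regroup = solve-∀

  eval-*ᴾ : ∀ (ρ : Vec Bool n) p q → eval ρ (p *ᴾ q) ≡ eval ρ p * eval ρ q
  eval-*ᴾ ρ  𝟘         q       = refl
  eval-*ᴾ [] (con c)   𝟘       = sym (ℤ.*-zeroʳ c)
  eval-*ᴾ [] (con c)   (con d) = refl
  eval-*ᴾ ρ@(_ ∷ _) p@(_ +x* _) 𝟘 = sym (ℤ.*-zeroʳ (eval ρ p))
  eval-*ᴾ (b ∷ ρ) (p₀ +x* p₁) (q₀ +x* q₁) = begin
    eval ρ (p₀ *ᴾ q₀ +ᴾ p₁ *ᴾ q₁) + sign b * eval ρ (p₀ *ᴾ q₁ +ᴾ p₁ *ᴾ q₀)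
      ≡⟨ cong₂ (λ i j → i + sign b * j) (eval-dot p₀ q₀ p₁ q₁) (eval-dot p₀ q₁ p₁ q₀) ⟩
    (e p₀ * e q₀ + e p₁ * e q₁) + sign b * (e p₀ * e q₁ + e p₁ * e q₀)
      ≡⟨ cong (λ c → (e p₀ * e q₀ + c) + sign b * (e p₀ * e q₁ + e p₁ * e q₀)) (sym (ℤ.*-identityˡ (e p₁ * e q₁))) ⟩
    (e p₀ * e q₀ + 1ℤ * (e p₁ * e q₁)) + sign b * (e p₀ * e q₁ + e p₁ * e q₀)
      ≡⟨ cong (λ c → (e p₀ * e q₀ + c * (e p₁ * e q₁)) + sign b * (e p₀ * e q₁ + e p₁ * e q₀)) (sign-square b) ⟨
    (e p₀ * e q₀ + sign b * sign b * (e p₁ * e q₁)) + sign b * (e p₀ * e q₁ + e p₁ * e q₀)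
      ≡⟨ factor (e p₀) (e q₀) (sign b) (e p₁) (e q₁) ⟩
    (e p₀ + sign b * e p₁) * (e q₀ + sign b * e q₁) ∎
    where
    e : Poly _ → ℤ
    e = eval ρ
    eval-dot : ∀ p q p′ q′ → e (p *ᴾ q +ᴾ p′ *ᴾ q′) ≡ e p * e q + e p′ * e q′
    eval-dot p q p′ q′ = trans (eval-+ᴾ ρ (p *ᴾ q) (p′ *ᴾ q′)) (cong₂ _+_ (eval-*ᴾ ρ p q) (eval-*ᴾ ρ p′ q′))
    factor : ∀ p₀ q₀ s p₁ q₁ → (p₀ * q₀ + s * s * (p₁ * q₁)) + s * (p₀ * q₁ + p₁ * q₀) ≡ (p₀ + s * p₁) * (q₀ + s * q₁)
    factor = solve-∀

polySemiring : ℕ → RawSemiring 0ℓ 0ℓ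
polySemiring n = record
  { Carrier = Poly n ; _≈_ = _≡_ ; _+_ = _+ᴾ_ ; _*_ = _*ᴾ_ ; 0# = 𝟘 ; 1# = const n 1ℤ }

eval-homo : (ρ : Vec Bool n) → SemiringMorphisms.IsSemiringHomomorphism (polySemiring n) ℤ.+-*-rawSemiring (eval ρ)
eval-homo ρ = record
  { isNearSemiringHomomorphism = record
    { +-isMonoidHomomorphism = record
      { isMagmaHomomorphism = record
        { isRelHomomorphism = record { cong = cong (eval ρ) }
        ; homo              = eval-+ᴾ ρ
        }
      ; ε-homo = refl
      }
    ; *-homo = eval-*ᴾ ρ
    }
  ; 1#-homo = eval-const ρ 1ℤ
  }

minimum : Poly n → ℤ
minimum 𝟘         = 0ℤ
minimum (con c)   = c
minimum (p +x* q) = minimum (p +ᴾ q) ⊓ minimum (p +ᴾ -ᴾ q)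

minimum-≤-eval : ∀ (ρ : Vec Bool n) p → minimum p ≤ eval ρ p
minimum-≤-eval ρ  𝟘       = ℤ.≤-refl
minimum-≤-eval [] (con c) = ℤ.≤-refl
minimum-≤-eval (true ∷ ρ) (p +x* q) = begin
  minimum (p +x* q)         ≤⟨ ℤ.i⊓j≤i _ (minimum (p +ᴾ -ᴾ q)) ⟩
  minimum (p +ᴾ q)          ≤⟨ minimum-≤-eval ρ (p +ᴾ q) ⟩
  eval ρ (p +ᴾ q)           ≡⟨ eval-+ᴾ ρ p q ⟩
  eval ρ p + eval ρ q       ≡⟨ cong (λ j → eval ρ p + j) (ℤ.*-identityˡ (eval ρ q)) ⟨
  eval ρ p + 1ℤ * eval ρ q  ∎
  where open ℤ.≤-Reasoning
minimum-≤-eval (false ∷ ρ) (p +x* q) = begin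
  minimum (p +x* q)          ≤⟨ ℤ.i⊓j≤j (minimum (p +ᴾ q)) _ ⟩
  minimum (p +ᴾ -ᴾ q)        ≤⟨ minimum-≤-eval ρ (p +ᴾ -ᴾ q) ⟩
  eval ρ (p +ᴾ -ᴾ q)         ≡⟨ eval-+ᴾ ρ p (-ᴾ q) ⟩
  eval ρ p + eval ρ (-ᴾ q)   ≡⟨ cong (λ j → eval ρ p + j) (trans (eval--ᴾ ρ q) (sym (ℤ.-1*i≡-i (eval ρ q)))) ⟩
  eval ρ p + -1ℤ * eval ρ q  ∎
  where open ℤ.≤-Reasoning

var : Fin m → Poly (m ℕ.+ n)
var zero    = 𝟘 +x* const _ 1ℤ
var (suc i) = var i +x* 𝟘

weaken : ∀ m → Poly n → Poly (m ℕ.+ n)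
weaken zero    p = p
weaken (suc m) p = weaken m p +x* 𝟘

eval-+x*𝟘 : ∀ b (ρ : Vec Bool n) p → eval (b ∷ ρ) (p +x* 𝟘) ≡ eval ρ p
eval-+x*𝟘 b ρ p = trans (cong (λ j → eval ρ p + j) (ℤ.*-zeroʳ (sign b))) (ℤ.+-identityʳ (eval ρ p))

eval-var : ∀ (σ : Vec Bool m) (ρ : Vec Bool n) i → eval (σ Vec.++ ρ) (var i) ≡ sign (Vec.lookup σ i)
eval-var (b ∷ σ) ρ zero    = begin
  0ℤ + sign b * eval (σ Vec.++ ρ) (const _ 1ℤ)  ≡⟨ ℤ.+-identityˡ _ ⟩
  sign b * eval (σ Vec.++ ρ) (const _ 1ℤ)       ≡⟨ cong (sign b *_) (eval-const (σ Vec.++ ρ) 1ℤ) ⟩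
  sign b * 1ℤ                                   ≡⟨ ℤ.*-identityʳ (sign b) ⟩
  sign b                                        ∎
  where open ≡-Reasoning
eval-var (b ∷ σ) ρ (suc i) = trans (eval-+x*𝟘 b (σ Vec.++ ρ) (var i)) (eval-var σ ρ i)

eval-weaken : ∀ (σ : Vec Bool m) (ρ : Vec Bool n) p → eval (σ Vec.++ ρ) (weaken m p) ≡ eval ρ p
eval-weaken []      ρ p = refl
eval-weaken (b ∷ σ) ρ p = trans (eval-+x*𝟘 b (σ Vec.++ ρ) (weaken _ p)) (eval-weaken σ ρ p)

-- Hamiltonian paths

Arc : (A → A → Bool) → A → A → Set
Arc t x y = t x y ≡ true

Skew : (A → A → Bool) → A → A → Set
Skew t x y = t y x ≡ not (t x y)

module _ (t : A → A → Bool) where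

  Skew-sym : Symmetric (Skew t)
  Skew-sym {x} {y} t-yx = sym (trans (cong not t-yx) (not-involutive (t x y)))

  insert : A → List A → List A
  insert x []       = x ∷ []
  insert x (y ∷ ys) = if t x y then x ∷ y ∷ ys else y ∷ insert x ys

  insert-↭ : ∀ x ys → insert x ys ↭ x ∷ ys
  insert-↭ x []       = refl
  insert-↭ x (y ∷ ys) with t x y
  ... | true  = refl
  ... | false = ↭-trans (prep y (insert-↭ x ys)) (swap y x refl)

  insert-Linked⁺ : ∀ {x y ys} → All (Skew t x) ys → Arc t y x →
    Linked (Arc t) (y ∷ ys) → Linked (Arc t) (y ∷ insert x ys)
  insert-Linked⁺ {ys = []}        _               y→x _           = y→x ∷ [-]
  insert-Linked⁺ {x} {ys = z ∷ _} (skew ∷ skews) y→x (y→z ∷ zs) with t x z in x→z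
  ... | true  = y→x ∷ x→z ∷ zs
  ... | false = y→z ∷ insert-Linked⁺ skews skew zs

  insert-Linked : ∀ {x ys} → All (Skew t x) ys → Linked (Arc t) ys → Linked (Arc t) (insert x ys)
  insert-Linked {ys = []}        _              _      = [-]
  insert-Linked {x} {ys = y ∷ _} (skew ∷ skews) linked with t x y in x→y
  ... | true  = x→y ∷ linked
  ... | false = insert-Linked⁺ skews skew linked

  -- Rédei's theorem
  hamiltonianPath : ∀ xs → AllPairs (Skew t) xs → ∃ λ ys → xs ↭ ys × Linked (Arc t) ys
  hamiltonianPath []       _              = [] , refl , []
  hamiltonianPath (x ∷ xs) (skew ∷ skews) with hamiltonianPath xs skews
  ... | ys , xs↭ys , linked =
    insert x ys , ↭-trans (prep x xs↭ys) (↭-sym (insert-↭ x ys)) , insert-Linked (All-resp-↭ xs↭ys skew) linked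

-- Signed sums over the orderings of a tournament

numOtherArcs : ℕ → ℕ
numOtherArcs zero    = 0
numOtherArcs (suc m) = pred m ℕ.+ numOtherArcs m

genericRow : Fin m → Poly (pred m ℕ.+ n)
genericRow zero    = const _ 1ℤ
genericRow (suc j) = var j

-- The signs of a tournament on Fin m with an arc from each i to i + 1 and the other arcs unknown.
genericSigns : ∀ m → Fin m → Fin m → Poly (numOtherArcs m)
genericSigns (suc m) zero    zero    = 𝟘
genericSigns (suc m) zero    (suc j) = genericRow j
genericSigns (suc m) (suc i) zero    = -ᴾ genericRow i
genericSigns (suc m) (suc i) (suc j) = weaken (pred m) (genericSigns m i j)

ArcsToNext : (Fin m → Fin m → Bool) → Set
ArcsToNext t = ∀ {i j} → suc (toℕ i) ≡ toℕ j → t i j ≡ true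

rowArcs : (Fin (suc m) → Fin (suc m) → Bool) → Vec Bool (pred m)
rowArcs {zero}  t = []
rowArcs {suc m} t = Vec.tabulate λ j → t zero (suc (suc j))

otherArcs : (Fin m → Fin m → Bool) → Vec Bool (numOtherArcs m)
otherArcs {zero}  t = []
otherArcs {suc m} t = rowArcs t Vec.++ otherArcs (t on suc)

eval-genericRow : ∀ (t : Fin (suc m) → Fin (suc m) → Bool) → ArcsToNext t → ∀ (ρ : Vec Bool n) j →
  eval (rowArcs t Vec.++ ρ) (genericRow j) ≡ sign (t zero (suc j))
eval-genericRow t t-next ρ zero    = trans (eval-const (rowArcs t Vec.++ ρ) 1ℤ) (cong sign (sym (t-next refl)))
eval-genericRow t t-next ρ (suc j) =
  trans (eval-var (rowArcs t) ρ j) (cong sign (Vec.lookup∘tabulate (λ j → t zero (suc (suc j))) j))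

eval-genericSigns : ∀ (t : Fin m → Fin m → Bool) → (∀ {i j} → i ≢ j → Skew t i j) → ArcsToNext t →
  ∀ {i j} → i ≢ j → eval (otherArcs t) (genericSigns m i j) ≡ sign (t i j)
eval-genericSigns t t-skew t-next {zero}  {zero}  0≢0 = contradiction refl 0≢0
eval-genericSigns t t-skew t-next {zero}  {suc j} _   = eval-genericRow t t-next (otherArcs (t on suc)) j
eval-genericSigns t t-skew t-next {suc i} {zero}  _   = begin
  eval (otherArcs t) (-ᴾ genericRow i)  ≡⟨ eval--ᴾ (otherArcs t) (genericRow i) ⟩
  - eval (otherArcs t) (genericRow i)   ≡⟨ cong -_ (eval-genericRow t t-next (otherArcs (t on suc)) i) ⟩
  - sign (t zero (suc i))               ≡⟨ sign-not (t zero (suc i)) ⟨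
  sign (not (t zero (suc i)))           ≡⟨ cong sign (t-skew λ ()) ⟨
  sign (t (suc i) zero)                 ∎
  where open ≡-Reasoning
eval-genericSigns {suc m} t t-skew t-next {suc i} {suc j} i≢j = trans
  (eval-weaken (rowArcs t) (otherArcs (t on suc)) (genericSigns m i j))
  (eval-genericSigns (t on suc) (λ i≢j → t-skew (i≢j ∘ Fin.suc-injective)) (λ i+1≡j → t-next (cong suc i+1≡j))
    (i≢j ∘ cong suc))

signedPaths : (A → A → Bool) → List A → ℤ
signedPaths t xs = hamPaths (λ x y → sign (t x y)) (pred (length xs)) xs

genericSignedPaths : ∀ m → Poly (numOtherArcs m)
genericSignedPaths m = PathSums.hamPaths (polySemiring (numOtherArcs m)) (genericSigns m) (pred m) (allFin m)

minSignedPaths : ℕ → ℤ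
minSignedPaths m = minimum (genericSignedPaths m)

-- Up to sign, a tangent number when m is odd.
transitiveSignedPaths : ℕ → ℤ
transitiveSignedPaths m = hamPaths (λ (i j : Fin m) → sign (toℕ i <ᵇ toℕ j)) (pred m) (allFin m)

AllPairs-lookup : ∀ {R : A → A → Set} {xs} → AllPairs R xs → ∀ {i j} → i Fin.< j → R (lookup xs i) (lookup xs j)
AllPairs-lookup (rs ∷ _)  {zero}  {suc j} _           = All.lookup rs (∈-lookup j)
AllPairs-lookup (_ ∷ rss) {suc i} {suc j} (ℕ.s≤s i<j) = AllPairs-lookup rss i<j

Linked-lookup : ∀ {R : A → A → Set} {xs} → Linked R xs → ∀ {i j} → suc (toℕ i) ≡ toℕ j → R (lookup xs i) (lookup xs j)
Linked-lookup (r ∷ _)  {zero}  {suc zero} _     = r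
Linked-lookup (_ ∷ rs) {suc i} {suc j}    i+1≡j = Linked-lookup rs (ℕ.suc-injective i+1≡j)

<ᵇ-true : ∀ {a b} → a ℕ.< b → (a <ᵇ b) ≡ true
<ᵇ-true = Equivalence.to T-≡ ∘ ℕ.<⇒<ᵇ

<ᵇ-false : ∀ {a b} → b ℕ.≤ a → (a <ᵇ b) ≡ false
<ᵇ-false {a} {b} b≤a with a <ᵇ b in a<ᵇb
... | false = refl
... | true  = contradiction b≤a (ℕ.<⇒≱ (ℕ.<ᵇ⇒< a b (Equivalence.from T-≡ a<ᵇb)))

module _ (t : A → A → Bool) where

  lookup-Skew : ∀ {xs} → AllPairs (Skew t) xs → ∀ {i j} → i ≢ j → Skew (t on lookup xs) i j
  lookup-Skew skew {i} {j} i≢j with Fin.<-cmp i j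
  ... | tri< i<j _   _   = AllPairs-lookup skew i<j
  ... | tri≈ _   i≡j _   = contradiction i≡j i≢j
  ... | tri> _   _   j<i = Skew-sym t (AllPairs-lookup skew j<i)

  signedPaths-↭ : ∀ {xs ys} → xs ↭ ys → signedPaths t xs ≡ signedPaths t ys
  signedPaths-↭ {xs} {ys} p = trans (hamPaths-↭ (λ x y → sign (t x y)) (pred (length xs)) p)
    (cong (λ l → hamPaths (λ x y → sign (t x y)) (pred l) ys) (↭-length p))

  signedPaths-positions : ∀ xs {s : Fin (length xs) → Fin (length xs) → ℤ} →
    (∀ {i j} → i ≢ j → sign (t (lookup xs i) (lookup xs j)) ≡ s i j) →
    signedPaths t xs ≡ hamPaths s (pred (length xs)) (allFin (length xs))
  signedPaths-positions xs {s} signs≡s = begin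
    signedPaths t xs
      ≡⟨ cong (hamPaths _ (pred (length xs))) (trans (List.map-tabulate id (lookup xs)) (List.tabulate-lookup xs)) ⟨
    hamPaths (λ x y → sign (t x y)) (pred (length xs)) (map (lookup xs) (allFin (length xs)))
      ≡⟨ hamPaths-map (lookup xs) _ (pred (length xs)) (allFin (length xs)) ⟩
    hamPaths (λ i j → sign (t (lookup xs i) (lookup xs j))) (pred (length xs)) (allFin (length xs))
      ≡⟨ hamPaths-cong (pred (length xs)) (allFin (length xs))
           (AllPairs.map (λ i≢j → signs≡s i≢j , signs≡s (i≢j ∘ sym)) (allFin⁺ (length xs))) ⟩
    hamPaths s (pred (length xs)) (allFin (length xs)) ∎
    where open ≡-Reasoning

  minSignedPaths-≤ : ∀ xs → AllPairs (Skew t) xs → minSignedPaths (length xs) ≤ signedPaths t xs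
  minSignedPaths-≤ xs skew with hamiltonianPath t xs skew
  ... | ys , xs↭ys , linked = begin
    minSignedPaths (length xs)
      ≡⟨ cong minSignedPaths (↭-length xs↭ys) ⟩
    minSignedPaths l
      ≤⟨ minimum-≤-eval ρ (genericSignedPaths l) ⟩
    eval ρ (genericSignedPaths l)
      ≡⟨ hamPaths-homo (eval-homo ρ) (genericSigns l) (pred l) (allFin l) ⟩
    hamPaths (λ i j → eval ρ (genericSigns l i j)) (pred l) (allFin l)
      ≡⟨ signedPaths-positions ys (λ i≢j → sym (eval-genericSigns (t on lookup ys)
           (lookup-Skew (AllPairs-resp-↭ (Skew-sym t) xs↭ys skew)) (Linked-lookup linked) i≢j)) ⟨
    signedPaths t ys
      ≡⟨ signedPaths-↭ xs↭ys ⟨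
    signedPaths t xs ∎
    where
    open ℤ.≤-Reasoning
    l : ℕ
    l = length ys
    ρ : Vec Bool (numOtherArcs l)
    ρ = otherArcs (t on lookup ys)

  signedPaths-transitive : Transitive (Arc t) → ∀ xs → AllPairs (Skew t) xs →
    signedPaths t xs ≡ transitiveSignedPaths (length xs)
  signedPaths-transitive Arc-trans xs skew with hamiltonianPath t xs skew
  ... | ys , xs↭ys , linked = begin
    signedPaths t xs                   ≡⟨ signedPaths-↭ xs↭ys ⟩
    signedPaths t ys                   ≡⟨ signedPaths-positions ys (cong sign ∘ ordered) ⟩
    transitiveSignedPaths (length ys)  ≡⟨ cong transitiveSignedPaths (↭-length xs↭ys) ⟨
    transitiveSignedPaths (length xs)  ∎
    where
    open ≡-Reasoning
    forward : ∀ {i j} → i Fin.< j → t (lookup ys i) (lookup ys j) ≡ true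
    forward = AllPairs-lookup (Linked⇒AllPairs Arc-trans linked)
    ordered : ∀ {i j} → i ≢ j → t (lookup ys i) (lookup ys j) ≡ (toℕ i <ᵇ toℕ j)
    ordered {i} {j} i≢j with Fin.<-cmp i j
    ... | tri< i<j _   _   = trans (forward i<j) (sym (<ᵇ-true i<j))
    ... | tri≈ _   i≡j _   = contradiction i≡j i≢j
    ... | tri> _   _   j<i = begin
      t (lookup ys i) (lookup ys j)        ≡⟨ AllPairs-lookup (AllPairs-resp-↭ (Skew-sym t) xs↭ys skew) j<i ⟩
      not (t (lookup ys j) (lookup ys i))  ≡⟨ cong not (forward j<i) ⟩
      false                                ≡⟨ <ᵇ-false (ℕ.<⇒≤ j<i) ⟨
      (toℕ i <ᵇ toℕ j)                     ∎

-- The trace of a power of J + K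

-- With u the column of ones, J = u uᵀ and m i = uᵀ Kⁱ u, walks a j is uᵀ (J + K)ʲ Kᵃ u and excess k is
-- tr (J + K)ᵏ⁺¹ - tr Kᵏ⁺¹. The ring is arbitrary so that the solver can evaluate them on its polynomials.
module Moments {X : Set} (_⊕_ _⊗_ : X → X → X) (m : ℕ → X) where

  walks : ℕ → ℕ → X
  walks a zero    = m a
  walks a (suc j) = (m a ⊗ walks 0 j) ⊕ walks (suc a) j

  excessFrom : ℕ → ℕ → X
  excessFrom a zero    = m a
  excessFrom a (suc k) = walks a (suc k) ⊕ excessFrom (suc a) k

  excess : ℕ → X
  excess = excessFrom 0

open Moments _+_ _*_

walks-cong : ∀ {m m′} → m ≗ m′ → ∀ a j → walks m a j ≡ walks m′ a j
walks-cong m≗m′ a zero    = m≗m′ a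
walks-cong m≗m′ a (suc j) = cong₂ _+_ (cong₂ _*_ (m≗m′ a) (walks-cong m≗m′ 0 j)) (walks-cong m≗m′ (suc a) j)

excessFrom-cong : ∀ {m m′} → m ≗ m′ → ∀ a k → excessFrom m a k ≡ excessFrom m′ a k
excessFrom-cong m≗m′ a zero    = m≗m′ a
excessFrom-cong m≗m′ a (suc k) = cong₂ _+_ (walks-cong m≗m′ a (suc k)) (excessFrom-cong m≗m′ (suc a) k)

module Matrices (n : ℕ) where
  open Sums n

  Matrix : Set
  Matrix = Fin n → Fin n → ℤ

  apply : Matrix → Vector ℤ n → Vector ℤ n
  apply A f x = ∑ λ y → A x y * f y

  power : Matrix → ℕ → Vector ℤ n → Vector ℤ n
  power A zero    f = f
  power A (suc k) f = apply A (power A k f)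

  -- The trace of Aᵏ⁺¹.
  trace : Matrix → ℕ → ℤ
  trace A k = ∑ λ z → power A k (λ x → A x z) z

  exchange : ∀ a b c → a * (b * c) ≡ b * (a * c)
  exchange = solve-∀

  module _ (A : Matrix) where
    open ≡-Reasoning

    apply-cong : ∀ {f g} → f ≗ g → apply A f ≗ apply A g
    apply-cong f≗g x = ∑-cong λ y → cong (A x y *_) (f≗g y)

    power-cong : ∀ k {f g} → f ≗ g → power A k f ≗ power A k g
    power-cong zero    f≗g = f≗g
    power-cong (suc k) f≗g = apply-cong (power-cong k f≗g)

    power-suc : ∀ k f → power A (suc k) f ≗ power A k (apply A f)
    power-suc zero    f x = refl
    power-suc (suc k) f x = apply-cong (power-suc k f) x

    power-distrib-+ : ∀ k f g x → power A k (λ y → f y + g y) x ≡ power A k f x + power A k g x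
    power-distrib-+ zero    f g x = refl
    power-distrib-+ (suc k) f g x = begin
      apply A (power A k λ y → f y + g y) x                    ≡⟨ apply-cong (power-distrib-+ k f g) x ⟩
      ∑ (λ y → A x y * (power A k f y + power A k g y))        ≡⟨ ∑-cong (λ y → ℤ.*-distribˡ-+ (A x y) _ _) ⟩
      ∑ (λ y → A x y * power A k f y + A x y * power A k g y)  ≡⟨ ∑-distrib-+ _ _ ⟩
      power A (suc k) f x + power A (suc k) g x                ∎

    power-distrib-∑ : ∀ k (c : Vector ℤ n) (f : Fin n → Vector ℤ n) x →
      power A k (λ y → ∑ λ z → c z * f z y) x ≡ ∑ λ z → c z * power A k (f z) x
    power-distrib-∑ zero    c f x = refl
    power-distrib-∑ (suc k) c f x = begin
      apply A (power A k λ y → ∑ λ z → c z * f z y) x  ≡⟨ apply-cong (power-distrib-∑ k c f) x ⟩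
      ∑ (λ y → A x y * ∑ (λ z → c z * g z y))          ≡⟨ ∑-cong (λ y → *-distribˡ-∑ (A x y) _) ⟩
      ∑ (λ y → ∑ λ z → A x y * (c z * g z y))          ≡⟨ ∑-comm (λ y z → A x y * (c z * g z y)) ⟩
      ∑ (λ z → ∑ λ y → A x y * (c z * g z y))          ≡⟨ ∑-cong (λ z → ∑-cong λ y → exchange (A x y) (c z) (g z y)) ⟩
      ∑ (λ z → ∑ λ y → c z * (A x y * g z y))          ≡⟨ ∑-cong (λ z → *-distribˡ-∑ (c z) _) ⟨
      ∑ (λ z → c z * power A (suc k) (f z) x)          ∎
      where
      g : Fin n → Vector ℤ n
      g z = power A k (f z)

    power-* : ∀ k c f x → power A k (λ y → c * f y) x ≡ c * power A k f x
    power-* zero    c f x = refl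
    power-* (suc k) c f x = begin
      apply A (power A k λ y → c * f y) x    ≡⟨ apply-cong (power-* k c f) x ⟩
      ∑ (λ y → A x y * (c * power A k f y))  ≡⟨ ∑-cong (λ y → exchange (A x y) c (power A k f y)) ⟩
      ∑ (λ y → c * (A x y * power A k f y))  ≡⟨ *-distribˡ-∑ c _ ⟨
      c * power A (suc k) f x                ∎

    ∑-tuples-paths : ∀ g k v → ∑-tuples k (paths A g k v) ≡ + (k !) * power A k g v
    ∑-tuples-paths g zero    v = sym (ℤ.*-identityˡ (g v))
    ∑-tuples-paths g (suc k) v = begin
      ∑-tuples (suc k) (∑-pick λ x rest → A v x * paths A g k x rest)
        ≡⟨ ∑-tuples-pick n k (λ x rest → A v x * paths A g k x rest) ⟩
      + suc k * ∑ (λ x → ∑-tuples k λ rest → A v x * paths A g k x rest)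
        ≡⟨ cong (+ suc k *_) (∑-cong λ x → sym (*-distribˡ-∑-tuples k (A v x) (paths A g k x))) ⟩
      + suc k * ∑ (λ x → A v x * ∑-tuples k (paths A g k x))
        ≡⟨ cong (+ suc k *_) (∑-cong λ x →
             trans (cong (A v x *_) (∑-tuples-paths g k x)) (exchange (A v x) (+ (k !)) _)) ⟩
      + suc k * ∑ (λ x → + (k !) * (A v x * power A k g x))
        ≡⟨ cong (+ suc k *_) (*-distribˡ-∑ (+ (k !)) _) ⟨
      + suc k * (+ (k !) * power A (suc k) g v)
        ≡⟨ ℤ.*-assoc (+ suc k) (+ (k !)) _ ⟨
      + suc k * + (k !) * power A (suc k) g v
        ≡⟨ cong (_* power A (suc k) g v) (ℤ.pos-* (suc k) (k !)) ⟨
      + (suc k !) * power A (suc k) g v ∎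

  module TraceExpansion (K : Matrix) where
    open ≡-Reasoning

    J+K : Matrix
    J+K x y = 1ℤ + K x y

    Kᵏu : ℕ → Vector ℤ n
    Kᵏu k = power K k λ _ → 1ℤ

    moment : ℕ → ℤ
    moment k = ∑ (Kᵏu k)

    apply-J+K : ∀ f x → apply J+K f x ≡ ∑ f + apply K f x
    apply-J+K f x = begin
      ∑ (λ y → (1ℤ + K x y) * f y)  ≡⟨ ∑-cong (λ y → distrib (K x y) (f y)) ⟩
      ∑ (λ y → f y + K x y * f y)   ≡⟨ ∑-distrib-+ _ _ ⟩
      ∑ f + apply K f x             ∎
      where
      distrib : ∀ a b → (1ℤ + a) * b ≡ b + a * b
      distrib = solve-∀

    power-const : ∀ A k c x → power A k (λ _ → c) x ≡ c * power A k (λ _ → 1ℤ) x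
    power-const A k c x = trans (power-cong A k (λ _ → sym (ℤ.*-identityʳ c)) x) (power-* A k c (λ _ → 1ℤ) x)

    ∑-power-walks : ∀ a j → ∑ (power J+K j (Kᵏu a)) ≡ walks moment a j
    ∑-power-walks a zero    = refl
    ∑-power-walks a (suc j) = begin
      ∑ (power J+K (suc j) (Kᵏu a))
        ≡⟨ ∑-cong (λ x → trans (power-suc J+K j (Kᵏu a) x) (power-cong J+K j (apply-J+K (Kᵏu a)) x)) ⟩
      ∑ (power J+K j (λ x → moment a + Kᵏu (suc a) x))
        ≡⟨ ∑-cong (λ x → trans (power-distrib-+ J+K j _ (Kᵏu (suc a)) x)
             (cong (_+ power J+K j (Kᵏu (suc a)) x) (power-const J+K j (moment a) x))) ⟩
      ∑ (λ x → moment a * power J+K j (Kᵏu 0) x + power J+K j (Kᵏu (suc a)) x)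
        ≡⟨ trans (∑-distrib-+ _ _) (cong (_+ ∑ (power J+K j (Kᵏu (suc a)))) (sym (*-distribˡ-∑ (moment a) _))) ⟩
      moment a * ∑ (power J+K j (Kᵏu 0)) + ∑ (power J+K j (Kᵏu (suc a)))
        ≡⟨ cong₂ _+_ (cong (moment a *_) (∑-power-walks 0 j)) (∑-power-walks (suc a) j) ⟩
      moment a * walks moment 0 j + walks moment (suc a) j ∎

    -- The trace of Kᵃ (J + K)ᵏ⁺¹.
    mixedTrace : ℕ → ℕ → ℤ
    mixedTrace a k = ∑ λ z → power K a (power J+K k λ x → J+K x z) z

    ∑-Kᵏu-power : ∀ a k → ∑ (λ z → Kᵏu a z * ∑ (power J+K k λ x → J+K x z)) ≡ ∑ (power J+K (suc k) (Kᵏu a))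
    ∑-Kᵏu-power a k = begin
      ∑ (λ z → Kᵏu a z * ∑ (f z))                ≡⟨ ∑-cong (λ z → *-distribˡ-∑ (Kᵏu a z) _) ⟩
      ∑ (λ z → ∑ λ y → Kᵏu a z * f z y)          ≡⟨ ∑-comm (λ z y → Kᵏu a z * f z y) ⟩
      ∑ (λ y → ∑ λ z → Kᵏu a z * f z y)          ≡⟨ ∑-cong (power-distrib-∑ J+K k (Kᵏu a) λ z x → J+K x z) ⟨
      ∑ (power J+K k λ x → ∑ λ z → Kᵏu a z * J+K x z)
        ≡⟨ ∑-cong (power-cong J+K k λ x → ∑-cong λ z → ℤ.*-comm (Kᵏu a z) (J+K x z)) ⟩
      ∑ (power J+K k (apply J+K (Kᵏu a)))        ≡⟨ ∑-cong (power-suc J+K k (Kᵏu a)) ⟨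
      ∑ (power J+K (suc k) (Kᵏu a))              ∎
      where
      f : Fin n → Vector ℤ n
      f z = power J+K k λ x → J+K x z

    mixedTrace-excess : ∀ a k → mixedTrace a k ≡ trace K (a ℕ.+ k) + excessFrom moment a k
    mixedTrace-excess a zero    = begin
      ∑ (λ z → power K a (λ x → 1ℤ + K x z) z)       ≡⟨ ∑-cong (λ z → power-distrib-+ K a _ (λ x → K x z) z) ⟩
      ∑ (λ z → Kᵏu a z + power K a (λ x → K x z) z)  ≡⟨ ∑-distrib-+ (Kᵏu a) _ ⟩
      moment a + trace K a                           ≡⟨ ℤ.+-comm (moment a) (trace K a) ⟩
      trace K a + moment a                           ≡⟨ cong (λ i → trace K i + moment a) (ℕ.+-identityʳ a) ⟨
      trace K (a ℕ.+ 0) + moment a                   ∎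
    mixedTrace-excess a (suc k) = begin
      ∑ (λ z → power K a (apply J+K (f z)) z)
        ≡⟨ ∑-cong (λ z → trans (power-cong K a (apply-J+K (f z)) z) (power-distrib-+ K a _ (apply K (f z)) z)) ⟩
      ∑ (λ z → power K a (λ _ → ∑ (f z)) z + power K a (apply K (f z)) z)
        ≡⟨ ∑-cong (λ z → cong₂ _+_ (trans (power-const K a (∑ (f z)) z) (ℤ.*-comm _ (Kᵏu a z)))
                                   (sym (power-suc K a (f z) z))) ⟩
      ∑ (λ z → Kᵏu a z * ∑ (f z) + power K (suc a) (f z) z)
        ≡⟨ ∑-distrib-+ _ _ ⟩
      ∑ (λ z → Kᵏu a z * ∑ (f z)) + mixedTrace (suc a) k
        ≡⟨ cong₂ _+_ (trans (∑-Kᵏu-power a k) (∑-power-walks a (suc k))) (mixedTrace-excess (suc a) k) ⟩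
      W + (trace K (suc a ℕ.+ k) + E)
        ≡⟨ regroup W (trace K (suc a ℕ.+ k)) E ⟩
      trace K (suc a ℕ.+ k) + (W + E)
        ≡⟨ cong (λ i → trace K i + (W + E)) (ℕ.+-suc a k) ⟨
      trace K (a ℕ.+ suc k) + (W + E) ∎
      where
      f : Fin n → Vector ℤ n
      f z = power J+K k λ x → J+K x z
      W E : ℤ
      W = walks moment a (suc k)
      E = excessFrom moment (suc a) k
      regroup : ∀ w t e → w + (t + e) ≡ t + (w + e)
      regroup = solve-∀

    trace-excess : ∀ k → trace J+K k ≡ trace K k + excess moment k
    trace-excess = mixedTrace-excess 0

-- Skew-symmetric matrices

module Alternation {X : Set} (neg : X → X) (zero# : X) where

  alternate : (ℕ → X) → ℕ → X
  alternate e 0             = e 0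
  alternate e 1             = zero#
  alternate e (suc (suc k)) = neg (alternate (e ∘ suc) k)

open Alternation -_ 0ℤ

alternate-cong : ∀ {e e′} → e ≗ e′ → alternate e ≗ alternate e′
alternate-cong e≗e′ 0             = e≗e′ 0
alternate-cong e≗e′ 1             = refl
alternate-cong e≗e′ (suc (suc k)) = cong -_ (alternate-cong (e≗e′ ∘ suc) k)

-- For a skew-symmetric K, uᵀ Kᵏ u is ± |Kⁱ u|² if k = 2 i and 0 if k is odd. The deficit is nˡ - excess (l - 1) for
-- l = 4, 8, as a function of n = |u|², p = |K u|², q = |K² u|² and r = |K³ u|².
deficit₄ : ℤ → ℤ → ℤ
deficit₄ n p = + 4 * n * p

deficit₈ : ℤ → ℤ → ℤ → ℤ → ℤ
deficit₈ n p q r = + 8 * n ^ 5 * p + + 8 * n * r + + 8 * (p * q) - (+ 8 * n ^ 3 * q + + 12 * n ^ 2 * (p * p))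

module _ where
  open +-*-Solver

  private
    deficit₈ᴾ : ∀ {k} (n p q r : Polynomial k) → Polynomial k
    deficit₈ᴾ n p q r = con (+ 8) :* n :^ 5 :* p :+ con (+ 8) :* n :* r :+ con (+ 8) :* (p :* q)
      :- (con (+ 8) :* n :^ 3 :* q :+ con (+ 12) :* n :^ 2 :* (p :* p))

    excessᴾ : ∀ {k} (n p q r : Polynomial k) → ℕ → Polynomial k
    excessᴾ n p q r = Moments.excess _:+_ _:*_ (Alternation.alternate :-_ (con 0ℤ)
      λ { 0 → n ; 1 → p ; 2 → q ; 3 → r ; _ → con 0ℤ })

  excess₄ : ∀ e → excess (alternate e) 3 + deficit₄ (e 0) (e 1) ≡ e 0 ^ 4
  excess₄ e = solve 2 (λ n p → excessᴾ n p n n 3 :+ con (+ 4) :* n :* p := n :^ 4) refl (e 0) (e 1)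

  excess₈ : ∀ e → excess (alternate e) 7 + deficit₈ (e 0) (e 1) (e 2) (e 3) ≡ e 0 ^ 8
  excess₈ e = solve 4 (λ n p q r → excessᴾ n p q r 7 :+ deficit₈ᴾ n p q r := n :^ 8) refl (e 0) (e 1) (e 2) (e 3)

  2*deficit₈-expanded : ∀ n p q r → + 2 * deficit₈ n p q r
    ≡ + 4 * n * (+ 2 * + 2 * r + + 2 * + 2 * (n * n) * - q + n * n * (n * n) * p)
      + p * (+ 4 * + 4 * q + + 2 * + 4 * (+ 3 * (n * n)) * - p + + 3 * (n * n) * (+ 3 * (n * n)) * n + + 3 * n ^ 5)
  2*deficit₈-expanded = solve 4 (λ n p q r → con (+ 2) :* deficit₈ᴾ n p q r
    := con (+ 4) :* n :* (con (+ 2) :* con (+ 2) :* r :+ con (+ 2) :* con (+ 2) :* (n :* n) :* :- q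
                          :+ n :* n :* (n :* n) :* p)
      :+ p :* (con (+ 4) :* con (+ 4) :* q :+ con (+ 2) :* con (+ 4) :* (con (+ 3) :* (n :* n)) :* :- p
               :+ con (+ 3) :* (n :* n) :* (con (+ 3) :* (n :* n)) :* n :+ con (+ 3) :* n :^ 5)) refl

module SkewMatrices (n : ℕ) where
  open Sums n
  open Matrices n

  infix 9 ⟨_,_⟩
  ⟨_,_⟩ : Vector ℤ n → Vector ℤ n → ℤ
  ⟨ f , g ⟩ = ∑ λ x → f x * g x

  ⟨⟩-comm : ∀ f g → ⟨ f , g ⟩ ≡ ⟨ g , f ⟩
  ⟨⟩-comm f g = ∑-cong λ x → ℤ.*-comm (f x) (g x)

  norm² : Vector ℤ n → ℤ
  norm² f = ⟨ f , f ⟩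

  norm²-nonNeg : ∀ f → 0ℤ ≤ norm² f
  norm²-nonNeg f = subst (_≤ norm² f) ∑-zero (∑-mono-≤ λ x → 0≤i² (f x))

  norm²-linear : ∀ c d f g →
    norm² (λ x → c * f x + d * g x) ≡ c * c * norm² f + + 2 * c * d * ⟨ f , g ⟩ + d * d * norm² g
  norm²-linear c d f g = begin
    ∑ (λ x → (c * f x + d * g x) * (c * f x + d * g x))
      ≡⟨ ∑-cong (λ x → expand c d (f x) (g x)) ⟩
    ∑ (λ x → c * c * (f x * f x) + + 2 * c * d * (f x * g x) + d * d * (g x * g x))
      ≡⟨ trans (∑-distrib-+ _ _) (cong (_+ ∑ (λ x → d * d * (g x * g x))) (∑-distrib-+ _ _)) ⟩
    ∑ (λ x → c * c * (f x * f x)) + ∑ (λ x → + 2 * c * d * (f x * g x)) + ∑ (λ x → d * d * (g x * g x))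
      ≡⟨ cong₂ _+_ (cong₂ _+_ (*-distribˡ-∑ (c * c) _) (*-distribˡ-∑ (+ 2 * c * d) _)) (*-distribˡ-∑ (d * d) _) ⟨
    c * c * norm² f + + 2 * c * d * ⟨ f , g ⟩ + d * d * norm² g ∎
    where
    open ≡-Reasoning
    expand : ∀ c d x y → (c * x + d * y) * (c * x + d * y) ≡ c * c * (x * x) + + 2 * c * d * (x * y) + d * d * (y * y)
    expand = solve-∀

  module _ (K : Matrix) (K-skew : ∀ x y → K y x ≡ - K x y) where
    open TraceExpansion K

    apply-adjoint : ∀ f g → ⟨ f , apply K g ⟩ ≡ - ⟨ apply K f , g ⟩
    apply-adjoint f g = begin
      ∑ (λ x → f x * ∑ λ y → K x y * g y)      ≡⟨ ∑-cong (λ x → *-distribˡ-∑ (f x) _) ⟩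
      ∑ (λ x → ∑ λ y → f x * (K x y * g y))    ≡⟨ ∑-comm (λ x y → f x * (K x y * g y)) ⟩
      ∑ (λ y → ∑ λ x → f x * (K x y * g y))    ≡⟨ ∑-cong (λ y → ∑-cong λ x → transpose x y) ⟩
      ∑ (λ y → ∑ λ x → - g y * (K y x * f x))  ≡⟨ ∑-cong (λ y → *-distribˡ-∑ (- g y) _) ⟨
      ∑ (λ y → - g y * apply K f y)            ≡⟨ ∑-cong (λ y → negate (g y) (apply K f y)) ⟩
      ∑ (λ y → -1ℤ * (apply K f y * g y))      ≡⟨ *-distribˡ-∑ -1ℤ _ ⟨
      -1ℤ * ⟨ apply K f , g ⟩                  ≡⟨ ℤ.-1*i≡-i _ ⟩
      - ⟨ apply K f , g ⟩                      ∎
      where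
      open ≡-Reasoning
      regroup : ∀ a k b → a * (- k * b) ≡ - b * (k * a)
      regroup = solve-∀
      transpose : ∀ x y → f x * (K x y * g y) ≡ - g y * (K y x * f x)
      transpose x y = trans (cong (λ k → f x * (k * g y)) (K-skew y x)) (regroup (f x) (K y x) (g y))
      negate : ∀ b a → - b * a ≡ -1ℤ * (a * b)
      negate = solve-∀

    ⟨f,Kf⟩≡0 : ∀ f → ⟨ f , apply K f ⟩ ≡ 0ℤ
    ⟨f,Kf⟩≡0 f = i≡-i⇒i≡0 (trans (apply-adjoint f f) (cong -_ (⟨⟩-comm (apply K f) f)))

    ⟨f,Kᵏf⟩-alternate : ∀ k f → ⟨ f , power K k f ⟩ ≡ alternate (λ i → norm² (power K i f)) k
    ⟨f,Kᵏf⟩-alternate 0             f = refl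
    ⟨f,Kᵏf⟩-alternate 1             f = ⟨f,Kf⟩≡0 f
    ⟨f,Kᵏf⟩-alternate (suc (suc k)) f = begin
      ⟨ f , power K (suc (suc k)) f ⟩
        ≡⟨ apply-adjoint f (power K (suc k) f) ⟩
      - ⟨ apply K f , power K (suc k) f ⟩
        ≡⟨ cong -_ (∑-cong λ x → cong (apply K f x *_) (power-suc K k f x)) ⟩
      - ⟨ apply K f , power K k (apply K f) ⟩
        ≡⟨ cong -_ (⟨f,Kᵏf⟩-alternate k (apply K f)) ⟩
      - alternate (λ i → norm² (power K i (apply K f))) k
        ≡⟨ cong -_ (alternate-cong (λ i → ∑-cong λ x → cong₂ _*_ (power-suc K i f x) (power-suc K i f x)) k) ⟨
      - alternate (λ i → norm² (power K (suc i) f)) k ∎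
      where open ≡-Reasoning

    ∣Kᵏu∣² : ℕ → ℤ
    ∣Kᵏu∣² i = norm² (Kᵏu i)

    ∣u∣²≡n : ∣Kᵏu∣² 0 ≡ + n
    ∣u∣²≡n = trans (∑-const (1ℤ * 1ℤ)) (ℤ.*-identityʳ (+ n))

    moment-alternate : moment ≗ alternate ∣Kᵏu∣²
    moment-alternate k = trans (∑-cong λ x → sym (ℤ.*-identityˡ (Kᵏu k x))) (⟨f,Kᵏf⟩-alternate k (Kᵏu 0))

    trace+deficit : ∀ k {d a} → excess (alternate ∣Kᵏu∣²) k + d ≡ a → trace J+K k + d ≡ trace K k + a
    trace+deficit k {d} {a} excess+d≡a = begin
      trace J+K k + d
        ≡⟨ cong (_+ d) (trace-excess k) ⟩
      trace K k + excess moment k + d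
        ≡⟨ cong (λ E → trace K k + E + d) (excessFrom-cong moment-alternate 0 k) ⟩
      trace K k + excess (alternate ∣Kᵏu∣²) k + d
        ≡⟨ ℤ.+-assoc (trace K k) _ d ⟩
      trace K k + (excess (alternate ∣Kᵏu∣²) k + d)
        ≡⟨ cong (λ S → trace K k + S) excess+d≡a ⟩
      trace K k + a ∎
      where open ≡-Reasoning

    trace+deficit₄ : trace J+K 3 + deficit₄ (+ n) (∣Kᵏu∣² 1) ≡ trace K 3 + (+ n) ^ 4
    trace+deficit₄ = trace+deficit 3
      (subst (λ c → excess (alternate ∣Kᵏu∣²) 3 + deficit₄ c (∣Kᵏu∣² 1) ≡ c ^ 4) ∣u∣²≡n (excess₄ ∣Kᵏu∣²))

    trace+deficit₈ : trace J+K 7 + deficit₈ (+ n) (∣Kᵏu∣² 1) (∣Kᵏu∣² 2) (∣Kᵏu∣² 3) ≡ trace K 7 + (+ n) ^ 8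
    trace+deficit₈ = trace+deficit 7
      (subst (λ c → excess (alternate ∣Kᵏu∣²) 7 + deficit₈ c (∣Kᵏu∣² 1) (∣Kᵏu∣² 2) (∣Kᵏu∣² 3) ≡ c ^ 8) ∣u∣²≡n
        (excess₈ ∣Kᵏu∣²))

    deficit₄-nonNeg : 0ℤ ≤ deficit₄ (+ n) (∣Kᵏu∣² 1)
    deficit₄-nonNeg = *-nonNeg (*-nonNeg {+ 4} {+ n} (+≤+ ℕ.z≤n) (+≤+ ℕ.z≤n)) (norm²-nonNeg (Kᵏu 1))

    deficit₈-nonNeg : 0ℤ ≤ deficit₈ (+ n) (∣Kᵏu∣² 1) (∣Kᵏu∣² 2) (∣Kᵏu∣² 3)
    deficit₈-nonNeg = ℤ.*-cancelˡ-≤-pos 0ℤ _ (+ 2) (subst (0ℤ ≤_) sum-of-squares (ℤ.+-mono-≤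
      (*-nonNeg (*-nonNeg {+ 4} {+ n} (+≤+ ℕ.z≤n) (+≤+ ℕ.z≤n)) (norm²-nonNeg f))
      (*-nonNeg (norm²-nonNeg (Kᵏu 1)) (ℤ.+-mono-≤ (norm²-nonNeg g) (*-nonNeg {+ 3} (+≤+ ℕ.z≤n) (pos-^-nonNeg n 5))))))
      where
      n² : ℤ
      n² = + n * + n
      f g : Vector ℤ n
      f x = + 2 * Kᵏu 3 x + n² * Kᵏu 1 x
      g x = + 4 * Kᵏu 2 x + + 3 * n² * Kᵏu 0 x
      ∣f∣² : norm² f ≡ + 2 * + 2 * ∣Kᵏu∣² 3 + + 2 * + 2 * n² * - ∣Kᵏu∣² 2 + n² * n² * ∣Kᵏu∣² 1
      ∣f∣² = trans (norm²-linear (+ 2) n² (Kᵏu 3) (Kᵏu 1))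
        (cong (λ i → + 2 * + 2 * ∣Kᵏu∣² 3 + + 2 * + 2 * n² * i + n² * n² * ∣Kᵏu∣² 1)
          (trans (⟨⟩-comm (Kᵏu 3) (Kᵏu 1)) (apply-adjoint (Kᵏu 1) (Kᵏu 2))))
      ∣g∣² : norm² g ≡ + 4 * + 4 * ∣Kᵏu∣² 2 + + 2 * + 4 * (+ 3 * n²) * - ∣Kᵏu∣² 1 + + 3 * n² * (+ 3 * n²) * + n
      ∣g∣² = trans (norm²-linear (+ 4) (+ 3 * n²) (Kᵏu 2) (Kᵏu 0))
        (cong₂ (λ i c → + 4 * + 4 * ∣Kᵏu∣² 2 + + 2 * + 4 * (+ 3 * n²) * i + + 3 * n² * (+ 3 * n²) * c)
          (trans (⟨⟩-comm (Kᵏu 2) (Kᵏu 0)) (apply-adjoint (Kᵏu 0) (Kᵏu 1))) ∣u∣²≡n)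
      sum-of-squares : + 4 * + n * norm² f + ∣Kᵏu∣² 1 * (norm² g + + 3 * (+ n) ^ 5)
        ≡ + 2 * deficit₈ (+ n) (∣Kᵏu∣² 1) (∣Kᵏu∣² 2) (∣Kᵏu∣² 3)
      sum-of-squares = trans (cong₂ (λ F G → + 4 * + n * F + ∣Kᵏu∣² 1 * (G + + 3 * (+ n) ^ 5)) ∣f∣² ∣g∣²)
        (sym (2*deficit₈-expanded (+ n) (∣Kᵏu∣² 1) (∣Kᵏu∣² 2) (∣Kᵏu∣² 3)))

-- Closed walks

module ClosedWalks (n : ℕ) where
  open Sums n
  open Matrices n

  walk : Matrix → Fin n → Fin n → List (Fin n) → ℤ
  walk A z x []       = A x z
  walk A z x (y ∷ ys) = A x y * walk A z y ys

  closedWalk : Matrix → List (Fin n) → ℤ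
  closedWalk A []       = 1ℤ
  closedWalk A (x ∷ xs) = walk A x x xs

  ∑-tuples-walk : ∀ A k z x → ∑-tuples k (walk A z x) ≡ power A k (λ y → A y z) x
  ∑-tuples-walk A zero    z x = refl
  ∑-tuples-walk A (suc k) z x = ∑-cong λ y →
    trans (sym (*-distribˡ-∑-tuples k (A x y) (walk A z y))) (cong (A x y *_) (∑-tuples-walk A k z y))

  ∑-tuples-closedWalk : ∀ A k → ∑-tuples (suc k) (closedWalk A) ≡ trace A k
  ∑-tuples-closedWalk A k = ∑-cong λ x → ∑-tuples-walk A k x x

  walk-* : ∀ c A z x ys → walk (λ x y → + c * A x y) z x ys ≡ + (c ℕ.^ suc (length ys)) * walk A z x ys
  walk-* c A z x []       = cong (λ c′ → + c′ * A x z) (sym (ℕ.*-identityʳ c))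
  walk-* c A z x (y ∷ ys) = begin
    + c * A x y * walk (λ x y → + c * A x y) z y ys  ≡⟨ cong (+ c * A x y *_) (walk-* c A z y ys) ⟩
    + c * A x y * (+ p * walk A z y ys)              ≡⟨ regroup (+ c) (A x y) (+ p) (walk A z y ys) ⟩
    + c * + p * (A x y * walk A z y ys)              ≡⟨ cong (_* (A x y * walk A z y ys)) (ℤ.pos-* c p) ⟨
    + (c ℕ.* p) * (A x y * walk A z y ys)            ∎
    where
    open ≡-Reasoning
    p : ℕ
    p = c ℕ.^ suc (length ys)
    regroup : ∀ c a d w → c * a * (d * w) ≡ c * d * (a * w)
    regroup = solve-∀

  walk-const : ∀ c z x ys → walk (λ _ _ → + c) z x ys ≡ + (c ℕ.^ suc (length ys))
  walk-const c z x []       = cong +_ (sym (ℕ.*-identityʳ c))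
  walk-const c z x (y ∷ ys) = trans (cong (+ c *_) (walk-const c z y ys)) (sym (ℤ.pos-* c _))

  walk-nonNeg : ∀ {A} → (∀ x y → 0ℤ ≤ A x y) → ∀ z x ys → 0ℤ ≤ walk A z x ys
  walk-nonNeg 0≤A z x []       = 0≤A x z
  walk-nonNeg 0≤A z x (y ∷ ys) = *-nonNeg (0≤A x y) (walk-nonNeg 0≤A z y ys)

  walk-mono-≤ : ∀ {A B} → (∀ x y → 0ℤ ≤ A x y) → (∀ x y → A x y ≤ B x y) → ∀ z x ys → walk A z x ys ≤ walk B z x ys
  walk-mono-≤ 0≤A A≤B z x []       = A≤B x z
  walk-mono-≤ 0≤A A≤B z x (y ∷ ys) = *-mono-≤-nonNeg (0≤A x y)
    (walk-nonNeg (λ x y → ℤ.≤-trans (0≤A x y) (A≤B x y)) z y ys) (A≤B x y) (walk-mono-≤ 0≤A A≤B z y ys)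

  walk-cong-≢ : ∀ {A B} → (∀ {x y} → x ≢ y → A x y ≡ B x y) →
    ∀ z x ys → All (_≢ z) (x ∷ ys) → Unique (x ∷ ys) → walk A z x ys ≡ walk B z x ys
  walk-cong-≢ A≡B z x []       (x≢z ∷ [])  _                  = A≡B x≢z
  walk-cong-≢ A≡B z x (y ∷ ys) (_ ∷ ys≢z) ((x≢y ∷ _) ∷ ys!) = cong₂ _*_ (A≡B x≢y) (walk-cong-≢ A≡B z y ys ys≢z ys!)

  closedWalk-cong-≢ : ∀ {A B} → (∀ {x y} → x ≢ y → A x y ≡ B x y) →
    ∀ x y ys → Unique (x ∷ y ∷ ys) → closedWalk A (x ∷ y ∷ ys) ≡ closedWalk B (x ∷ y ∷ ys)
  closedWalk-cong-≢ A≡B x y ys ((x≢y ∷ x≢ys) ∷ ys!) =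
    cong₂ _*_ (A≡B x≢y) (walk-cong-≢ A≡B x y ys (All.map (_∘ sym) (x≢y ∷ x≢ys)) ys!)

-- The count of cyclic sequences as a sum over tuples

listSum : (A → ℤ) → List A → ℤ
listSum f []       = 0ℤ
listSum f (x ∷ xs) = f x + listSum f xs

listSum-cong : ∀ {f g : A → ℤ} → f ≗ g → listSum f ≗ listSum g
listSum-cong f≗g []       = refl
listSum-cong f≗g (x ∷ xs) = cong₂ _+_ (f≗g x) (listSum-cong f≗g xs)

listSum-++ : ∀ (f : A → ℤ) xs ys → listSum f (xs ++ ys) ≡ listSum f xs + listSum f ys
listSum-++ f []       ys = sym (ℤ.+-identityˡ _)
listSum-++ f (x ∷ xs) ys = trans (cong (λ S → f x + S) (listSum-++ f xs ys)) (sym (ℤ.+-assoc (f x) _ _))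

listSum-map : ∀ (f : B → ℤ) (g : A → B) xs → listSum f (map g xs) ≡ listSum (f ∘ g) xs
listSum-map f g []       = refl
listSum-map f g (x ∷ xs) = cong (λ S → f (g x) + S) (listSum-map f g xs)

listSum-concatMap : ∀ (f : B → ℤ) (g : A → List B) xs → listSum f (concatMap g xs) ≡ listSum (λ x → listSum f (g x)) xs
listSum-concatMap f g []       = refl
listSum-concatMap f g (x ∷ xs) =
  trans (listSum-++ f (g x) (concatMap g xs)) (cong (λ S → listSum f (g x) + S) (listSum-concatMap f g xs))

listSum-tabulate : ∀ (f : A → ℤ) (g : Fin n → A) → listSum f (tabulate g) ≡ sum (f ∘ g)
listSum-tabulate {n = zero}  f g = refl
listSum-tabulate {n = suc n} f g = cong (λ S → f (g zero) + S) (listSum-tabulate f (g ∘ suc))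

listSum-indicator : ∀ (P : A → Bool) xs → + length (filter (λ x → P x Bool.≟ true) xs) ≡ listSum (indicator ∘ P) xs
listSum-indicator P []       = refl
listSum-indicator P (x ∷ xs) with P x
... | true  = cong (λ S → 1ℤ + S) (listSum-indicator P xs)
... | false = trans (listSum-indicator P xs) (sym (ℤ.+-identityˡ _))

module _ {n : ℕ} where
  open Sums n

  listSum-allSeqs : ∀ ℓ F → listSum F (allSeqs n ℓ) ≡ ∑-tuples ℓ F
  listSum-allSeqs zero    F = ℤ.+-identityʳ (F [])
  listSum-allSeqs (suc ℓ) F = begin
    listSum F (allSeqs n (suc ℓ))
      ≡⟨ listSum-concatMap F (λ xs → map (_∷ xs) (allFin n)) (allSeqs n ℓ) ⟩
    listSum (λ xs → listSum F (map (_∷ xs) (allFin n))) (allSeqs n ℓ)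
      ≡⟨ listSum-cong (λ xs → trans (listSum-map F (_∷ xs) (allFin n)) (listSum-tabulate (λ x → F (x ∷ xs)) id))
           (allSeqs n ℓ) ⟩
    listSum (λ xs → ∑ λ x → F (x ∷ xs)) (allSeqs n ℓ)
      ≡⟨ listSum-allSeqs ℓ (λ xs → ∑ λ x → F (x ∷ xs)) ⟩
    ∑-tuples ℓ (λ xs → ∑ λ x → F (x ∷ xs))
      ≡⟨ ∑-tuples-∑-comm ℓ (λ x xs → F (x ∷ xs)) ⟩
    ∑-tuples (suc ℓ) F ∎
    where open ≡-Reasoning

  +cycleSeqs : ∀ T ℓ → + cycleSeqs T ℓ ≡ ∑-tuples ℓ (indicator ∘ isCycleSeq T)
  +cycleSeqs T ℓ = trans (listSum-indicator (isCycleSeq T) (allSeqs n ℓ)) (listSum-allSeqs ℓ (indicator ∘ isCycleSeq T))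

-- The matrix of a tournament

module _ {n : ℕ} (T : Tournament n) where
  open Sums n
  open Matrices n
  open ClosedWalks n
  open Repetitions n

  arcs : Matrix
  arcs x y = indicator (arc T x y)

  signs : Matrix
  signs x y = arcs x y - arcs y x

  open TraceExpansion signs

  signTrace walkTrace : ℕ → ℤ
  signTrace = trace signs
  walkTrace = trace J+K

  signs-skew : ∀ x y → signs y x ≡ - signs x y
  signs-skew x y = swapped (arcs x y) (arcs y x)
    where
    swapped : ∀ a b → b - a ≡ - (a - b)
    swapped = solve-∀

  signs-≢ : ∀ {x y} → x ≢ y → signs x y ≡ sign (arc T x y)
  signs-≢ {x} {y} x≢y rewrite total T y x (x≢y ∘ sym) with arc T x y
  ... | true  = refl
  ... | false = refl

  ∣signs∣≤1 : ∀ x y → ∣ signs x y ∣ ℕ.≤ 1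
  ∣signs∣≤1 x y with arc T x y | arc T y x
  ... | true  | true  = ℕ.z≤n
  ... | true  | false = ℕ.≤-refl
  ... | false | true  = ℕ.≤-refl
  ... | false | false = ℕ.z≤n

  J+K-≢ : ∀ {x y} → x ≢ y → J+K x y ≡ + 2 * arcs x y
  J+K-≢ {x} {y} x≢y rewrite signs-≢ x≢y with arc T x y
  ... | true  = refl
  ... | false = refl

  2*arcs-nonNeg : ∀ x y → 0ℤ ≤ + 2 * arcs x y
  2*arcs-nonNeg x y = *-nonNeg {+ 2} (+≤+ ℕ.z≤n) (indicator-nonNeg (arc T x y))

  2*arcs-≤-J+K : ∀ x y → + 2 * arcs x y ≤ J+K x y
  2*arcs-≤-J+K x y with x Fin.≟ y
  ... | no x≢y   = ℤ.≤-reflexive (sym (J+K-≢ x≢y))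
  ... | yes refl rewrite irrefl T x = +≤+ ℕ.z≤n

  J+K-≤2 : ∀ x y → J+K x y ≤ + 2
  J+K-≤2 x y = ℤ.+-monoʳ-≤ 1ℤ (ℤ.≤-trans (i≤+∣i∣ (signs x y)) (+≤+ (∣signs∣≤1 x y)))

  J+K-nonNeg : ∀ x y → 0ℤ ≤ J+K x y
  J+K-nonNeg x y = ℤ.≤-trans (2*arcs-nonNeg x y) (2*arcs-≤-J+K x y)

  walk-arcs : ∀ z x ys → walk arcs z x ys ≡ indicator (chain T (x ∷ ys) ∧ lastArc T z (x ∷ ys))
  walk-arcs z x []       = refl
  walk-arcs z x (y ∷ ys) = begin
    arcs x y * walk arcs z y ys                                        ≡⟨ cong (arcs x y *_) (walk-arcs z y ys) ⟩
    arcs x y * indicator (chain T (y ∷ ys) ∧ lastArc T z (y ∷ ys))     ≡⟨ indicator-∧ (arc T x y) _ ⟨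
    indicator (arc T x y ∧ (chain T (y ∷ ys) ∧ lastArc T z (y ∷ ys)))  ≡⟨ cong indicator (∧-assoc (arc T x y) _ _) ⟨
    indicator ((arc T x y ∧ chain T (y ∷ ys)) ∧ lastArc T z (y ∷ ys))  ∎
    where open ≡-Reasoning

  closedWalk-2*arcs : ∀ xs → closedWalk (λ x y → + 2 * arcs x y) xs ≡ + (2 ℕ.^ length xs) * indicator (closed T xs)
  closedWalk-2*arcs []       = refl
  closedWalk-2*arcs (x ∷ xs) = trans (walk-* 2 arcs x x xs) (cong (+ (2 ℕ.^ suc (length xs)) *_) (walk-arcs x x xs))

  2^ℓ*cycleSeqs : ∀ ℓ → + (2 ℕ.^ ℓ) * + cycleSeqs T ℓ ≡ ∑-tuples ℓ (λ xs → + (2 ℕ.^ ℓ) * indicator (isCycleSeq T xs))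
  2^ℓ*cycleSeqs ℓ =
    trans (cong (+ (2 ℕ.^ ℓ) *_) (+cycleSeqs T ℓ)) (*-distribˡ-∑-tuples ℓ (+ (2 ℕ.^ ℓ)) (indicator ∘ isCycleSeq T))

  2^ℓ*cycleSeqs-≤-walkTrace : ∀ k → + (2 ℕ.^ suc k) * + cycleSeqs T (suc k) ≤ walkTrace k
  2^ℓ*cycleSeqs-≤-walkTrace k =
    subst₂ _≤_ (sym (2^ℓ*cycleSeqs (suc k))) (∑-tuples-closedWalk J+K k) (∑-tuples-mono-≤ (suc k) pointwise)
    where
    open ℤ.≤-Reasoning
    indicator-∧-≤ʳ : ∀ a b → indicator (a ∧ b) ≤ indicator b
    indicator-∧-≤ʳ true  b = ℤ.≤-refl
    indicator-∧-≤ʳ false b = indicator-nonNeg b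
    pointwise : ∀ xs → length xs ≡ suc k → + (2 ℕ.^ suc k) * indicator (isCycleSeq T xs) ≤ closedWalk J+K xs
    pointwise xs@(x ∷ xs′) refl = begin
      + (2 ℕ.^ suc k) * indicator (isCycleSeq T xs)
        ≤⟨ ℤ.*-monoˡ-≤-nonNeg (+ (2 ℕ.^ suc k)) (indicator-∧-≤ʳ (distinct xs) (closed T xs)) ⟩
      + (2 ℕ.^ suc k) * indicator (closed T xs)
        ≡⟨ closedWalk-2*arcs xs ⟨
      closedWalk (λ x y → + 2 * arcs x y) xs
        ≤⟨ walk-mono-≤ 2*arcs-nonNeg 2*arcs-≤-J+K x x xs′ ⟩
      closedWalk J+K xs ∎

  walkTrace-≤-2^ℓ*cycleSeqs : ∀ k → let ℓ = suc (suc k) in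
    walkTrace (suc k) ≤ + (2 ℕ.^ ℓ) * + cycleSeqs T ℓ + + (2 ℕ.^ ℓ ℕ.* triangular ℓ) * (+ n) ^ suc k
  walkTrace-≤-2^ℓ*cycleSeqs k = subst₂ (λ S S′ → S ≤ S′ + + (p ℕ.* triangular ℓ) * (+ n) ^ suc k)
    (∑-tuples-closedWalk J+K (suc k)) (sym (2^ℓ*cycleSeqs ℓ)) (∑-tuples-mono-≤-distinct (suc k) p crude exact)
    where
    open ℤ.≤-Reasoning
    ℓ p : ℕ
    ℓ = suc (suc k)
    p = 2 ℕ.^ ℓ
    crude : ∀ xs → length xs ≡ ℓ → closedWalk J+K xs ≤ + p * indicator (isCycleSeq T xs) + + p
    crude xs@(x ∷ y ∷ ys) refl = begin
      closedWalk J+K xs                        ≤⟨ walk-mono-≤ J+K-nonNeg J+K-≤2 x x (y ∷ ys) ⟩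
      closedWalk (λ _ _ → + 2) xs              ≡⟨ walk-const 2 x x (y ∷ ys) ⟩
      0ℤ + + p                                 ≤⟨ ℤ.+-monoˡ-≤ (+ p) (*-nonNeg {+ p} (+≤+ ℕ.z≤n)
                                                    (indicator-nonNeg (isCycleSeq T xs))) ⟩
      + p * indicator (isCycleSeq T xs) + + p  ∎
    exact : ∀ xs → length xs ≡ ℓ → distinct xs ≡ true → closedWalk J+K xs ≤ + p * indicator (isCycleSeq T xs)
    exact xs@(x ∷ y ∷ ys) refl d = ℤ.≤-reflexive (begin-equality
      closedWalk J+K xs                       ≡⟨ closedWalk-cong-≢ J+K-≢ x y ys (distinct⇒Unique xs d) ⟩
      closedWalk (λ x y → + 2 * arcs x y) xs  ≡⟨ closedWalk-2*arcs xs ⟩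
      + p * indicator (closed T xs)           ≡⟨ cong (λ b → + p * indicator (b ∧ closed T xs)) d ⟨
      + p * indicator (isCycleSeq T xs)       ∎)

-- Closed orderings

module ClosedPaths (n : ℕ) where
  open Sums n
  open Matrices n

  closedPaths : Matrix → ℕ → List (Fin n) → ℤ
  closedPaths K k []       = 0ℤ
  closedPaths K k (v ∷ xs) = paths K (λ x → K x v) k v xs

  ∑-tuples-closedPaths : ∀ K k → ∑-tuples (suc k) (closedPaths K k) ≡ + (k !) * trace K k
  ∑-tuples-closedPaths K k =
    trans (∑-cong λ v → ∑-tuples-paths K (λ x → K x v) k v) (sym (*-distribˡ-∑ (+ (k !)) _))

  ∣closedPaths∣-≤ : ∀ {K} → (∀ x y → ∣ K x y ∣ ℕ.≤ 1) → ∀ k xs → length xs ≡ suc k → ∣ closedPaths K k xs ∣ ℕ.≤ k !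
  ∣closedPaths∣-≤ ∣K∣≤1 k (v ∷ xs) |xs| = ∣paths∣-≤ ∣K∣≤1 (λ x → ∣K∣≤1 x v) k v xs (ℕ.suc-injective |xs|)

sign-xor-xor : ∀ a b c → sign (a xor (b xor c)) ≡ sign a * (sign b * sign c)
sign-xor-xor a b c = begin
  sign (a xor (b xor c))            ≡⟨ sign-xor a (b xor c) ⟩
  - (sign a * sign (b xor c))       ≡⟨ cong (λ s → - (sign a * s)) (sign-xor b c) ⟩
  - (sign a * - (sign b * sign c))  ≡⟨ cancel (sign a) (sign b * sign c) ⟩
  sign a * (sign b * sign c)        ∎
  where
  open ≡-Reasoning
  cancel : ∀ i j → - (i * - j) ≡ i * j
  cancel = solve-∀

AllPairs-map-All : ∀ {P : A → Set} {R S : A → A → Set} → (∀ {x y} → P x → P y → R x y → S x y) →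
  ∀ {xs} → All P xs → AllPairs R xs → AllPairs S xs
AllPairs-map-All f []         []         = []
AllPairs-map-All f (px ∷ pxs) (rs ∷ rss) = All.zipWith (λ (py , r) → f px py r) (pxs , rs) ∷ AllPairs-map-All f pxs rss

module _ {n : ℕ} (T : Tournament n) where
  open Sums n
  open Matrices n
  open ClosedPaths n
  open Repetitions n

  -- Reverses the arcs between the vertices that dominate v and the others, so that v dominates all of them.
  switched : Fin n → Fin n → Fin n → Bool
  switched v x y = arc T x v xor (arc T x y xor arc T y v)

  switched-Skew : ∀ v {x y} → x ≢ y → Skew (switched v) x y
  switched-Skew v {x} {y} x≢y = trans
    (cong (λ b → arc T y v xor (b xor arc T x v)) (total T y x (x≢y ∘ sym)))
    (solve 3 (λ a b c → c :+ ((con true :+ b) :+ a) := con true :+ (a :+ (b :+ c))) refl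
      (arc T x v) (arc T x y) (arc T y v))
    where open xor-∧-Solver

  signs-switched : ∀ {v x y} → x ≢ v → y ≢ v → x ≢ y → signs T x y * signs T y v ≡ signs T x v * sign (switched v x y)
  signs-switched {v} {x} {y} x≢v y≢v x≢y rewrite signs-≢ T x≢v | signs-≢ T y≢v | signs-≢ T x≢y = begin
    b * c                      ≡⟨ ℤ.*-identityˡ (b * c) ⟨
    1ℤ * (b * c)               ≡⟨ cong (_* (b * c)) (sign-square (arc T x v)) ⟨
    a * a * (b * c)            ≡⟨ ℤ.*-assoc a a (b * c) ⟩
    a * (a * (b * c))          ≡⟨ cong (a *_) (sign-xor-xor (arc T x v) (arc T x y) (arc T y v)) ⟨
    a * sign (switched v x y)  ∎
    where
    open ≡-Reasoning
    a b c : ℤ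
    a = sign (arc T x v)
    b = sign (arc T x y)
    c = sign (arc T y v)

  module _ {v : Fin n} {xs : List (Fin n)} (v∷xs! : Unique (v ∷ xs)) where

    switched-AllPairs-Skew : AllPairs (Skew (switched v)) xs
    switched-AllPairs-Skew = AllPairs.map (switched-Skew v) (AllPairs.tail v∷xs!)

    closedPaths-switched : ∀ k → length xs ≡ suc k →
      closedPaths (signs T) (suc k) (v ∷ xs) ≡ - signedPaths (switched v) xs
    closedPaths-switched k |xs| = begin
      ∑-pick (λ x rest → signs T v x * paths (signs T) (λ x → signs T x v) k x rest) xs
        ≡⟨ ∑-pick-cong xs step ⟩
      ∑-pick (λ x rest → -1ℤ * paths s (λ _ → 1ℤ) k x rest) xs
        ≡⟨ *-distribˡ-∑-pick -1ℤ (paths s (λ _ → 1ℤ) k) xs ⟨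
      -1ℤ * hamPaths s k xs
        ≡⟨ ℤ.-1*i≡-i _ ⟩
      - hamPaths s k xs
        ≡⟨ cong (λ l → - hamPaths s (pred l) xs) |xs| ⟨
      - signedPaths (switched v) xs ∎
      where
      open ≡-Reasoning
      s : Matrix
      s x y = sign (switched v x y)
      ≢v : All (_≢ v) xs
      ≢v = All.map (_∘ sym) (AllPairs.head v∷xs!)
      allSwitched : AllPairs (Switched {s = signs T} {s} (λ x → signs T x v)) xs
      allSwitched = AllPairs-map-All
        (λ x≢v y≢v x≢y → signs-switched x≢v y≢v x≢y , signs-switched y≢v x≢v (x≢y ∘ sym)) ≢v (AllPairs.tail v∷xs!)
      step : ∀ x rest → x ∷ rest ↭ xs →
        signs T v x * paths (signs T) (λ x → signs T x v) k x rest ≡ -1ℤ * paths s (λ _ → 1ℤ) k x rest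
      step x rest p = begin
        signs T v x * paths (signs T) (λ x → signs T x v) k x rest
          ≡⟨ cong₂ _*_ (signs-skew T x v)
               (paths-switch (λ x → signs T x v) k x rest (AllPairs-resp-↭ symmetric (↭-sym p) allSwitched)) ⟩
        - signs T x v * (signs T x v * P)
          ≡⟨ cong (λ g → - g * (g * P)) (signs-≢ T (All.head (All-resp-↭ (↭-sym p) ≢v))) ⟩
        - g * (g * P)
          ≡⟨ regroup g P ⟩
        -1ℤ * (g * g) * P
          ≡⟨ cong (λ c → -1ℤ * c * P) (sign-square (arc T x v)) ⟩
        -1ℤ * P ∎
        where
        g P : ℤ
        g = sign (arc T x v)
        P = paths s (λ _ → 1ℤ) k x rest
        regroup : ∀ g p → - g * (g * p) ≡ -1ℤ * (g * g) * p
        regroup = solve-∀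

  module _ (k b : ℕ) where
    private
      j ℓ : ℕ
      j = suc k
      ℓ = suc j

    signTrace-≤ : minSignedPaths j ≡ - + b →
      + (j !) * signTrace T j ≤ (+ n) ^ ℓ * + b + + (j ! ℕ.* triangular ℓ) * (+ n) ^ j
    signTrace-≤ min≡-b = begin
      + (j !) * signTrace T j
        ≡⟨ ∑-tuples-closedPaths (signs T) j ⟨
      ∑-tuples ℓ (closedPaths (signs T) j)
        ≤⟨ ∑-tuples-mono-≤-distinct j (j !) crude sharp ⟩
      ∑-tuples ℓ (λ _ → + b) + + (j ! ℕ.* triangular ℓ) * (+ n) ^ j
        ≡⟨ cong (_+ + (j ! ℕ.* triangular ℓ) * (+ n) ^ j) (∑-tuples-const ℓ (+ b)) ⟩
      (+ n) ^ ℓ * + b + + (j ! ℕ.* triangular ℓ) * (+ n) ^ j ∎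
      where
      open ℤ.≤-Reasoning
      crude : ∀ xs → length xs ≡ ℓ → closedPaths (signs T) j xs ≤ + b + + (j !)
      crude xs |xs| = ℤ.≤-trans (i≤+∣i∣ (closedPaths (signs T) j xs))
        (+≤+ (ℕ.≤-trans (∣closedPaths∣-≤ (∣signs∣≤1 T) j xs |xs|) (ℕ.m≤n+m (j !) b)))
      sharp : ∀ xs → length xs ≡ ℓ → distinct xs ≡ true → closedPaths (signs T) j xs ≤ + b
      sharp (v ∷ xs) |xs| d = begin
        closedPaths (signs T) j (v ∷ xs)
          ≡⟨ closedPaths-switched v∷xs! k (ℕ.suc-injective |xs|) ⟩
        - signedPaths (switched v) xs
          ≤⟨ ℤ.neg-mono-≤ (minSignedPaths-≤ (switched v) xs (switched-AllPairs-Skew v∷xs!)) ⟩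
        - minSignedPaths (length xs)
          ≡⟨ cong -_ (trans (cong minSignedPaths (ℕ.suc-injective |xs|)) min≡-b) ⟩
        - - + b
          ≡⟨ ℤ.neg-involutive (+ b) ⟩
        + b ∎
        where
        v∷xs! : Unique (v ∷ xs)
        v∷xs! = distinct⇒Unique (v ∷ xs) d

    signTrace-≥ : transitiveSignedPaths j ≡ - + b → (∀ v → Transitive (Arc (switched v))) →
      (+ n) ^ ℓ * + b ≤ + (j !) * signTrace T j + + ((b ℕ.+ j !) ℕ.* triangular ℓ) * (+ n) ^ j
    signTrace-≥ transitive≡-b switched-trans = begin
      (+ n) ^ ℓ * + b
        ≡⟨ ∑-tuples-const ℓ (+ b) ⟨
      ∑-tuples ℓ (λ _ → + b)
        ≤⟨ ∑-tuples-mono-≤-distinct j (b ℕ.+ j !) crude exact ⟩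
      ∑-tuples ℓ (closedPaths (signs T) j) + + ((b ℕ.+ j !) ℕ.* triangular ℓ) * (+ n) ^ j
        ≡⟨ cong (_+ + ((b ℕ.+ j !) ℕ.* triangular ℓ) * (+ n) ^ j) (∑-tuples-closedPaths (signs T) j) ⟩
      + (j !) * signTrace T j + + ((b ℕ.+ j !) ℕ.* triangular ℓ) * (+ n) ^ j ∎
      where
      open ℤ.≤-Reasoning
      crude : ∀ xs → length xs ≡ ℓ → + b ≤ closedPaths (signs T) j xs + + (b ℕ.+ j !)
      crude xs |xs| = begin
        + b
          ≡⟨ cancel S (+ b) ⟩
        S + (+ b + - S)
          ≤⟨ ℤ.+-monoʳ-≤ S (ℤ.+-monoʳ-≤ (+ b) (i≤+∣i∣ (- S))) ⟩
        S + (+ b + + ∣ - S ∣)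
          ≡⟨ cong (λ a → S + (+ b + + a)) (ℤ.∣-i∣≡∣i∣ S) ⟩
        S + (+ b + + ∣ S ∣)
          ≤⟨ ℤ.+-monoʳ-≤ S (ℤ.+-monoʳ-≤ (+ b) (+≤+ (∣closedPaths∣-≤ (∣signs∣≤1 T) j xs |xs|))) ⟩
        S + + (b ℕ.+ j !) ∎
        where
        S : ℤ
        S = closedPaths (signs T) j xs
        cancel : ∀ s b → b ≡ s + (b + - s)
        cancel = solve-∀
      exact : ∀ xs → length xs ≡ ℓ → distinct xs ≡ true → + b ≤ closedPaths (signs T) j xs
      exact (v ∷ xs) |xs| d = ℤ.≤-reflexive (sym (begin-equality
        closedPaths (signs T) j (v ∷ xs)
          ≡⟨ closedPaths-switched v∷xs! k (ℕ.suc-injective |xs|) ⟩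
        - signedPaths (switched v) xs
          ≡⟨ cong -_ (signedPaths-transitive (switched v) (switched-trans v) xs (switched-AllPairs-Skew v∷xs!)) ⟩
        - transitiveSignedPaths (length xs)
          ≡⟨ cong -_ (trans (cong transitiveSignedPaths (ℕ.suc-injective |xs|)) transitive≡-b) ⟩
        - - + b
          ≡⟨ ℤ.neg-involutive (+ b) ⟩
        + b ∎))
        where
        v∷xs! : Unique (v ∷ xs)
        v∷xs! = distinct⇒Unique (v ∷ xs) d

-- The alternating tournament

even : Fin n → Bool
even zero    = true
even (suc i) = not (even i)

<ᵇ-swap : ∀ {i j : Fin n} → i ≢ j → (toℕ i <ᵇ toℕ j) ≡ not (toℕ j <ᵇ toℕ i)
<ᵇ-swap {i = i} {j} i≢j with Fin.<-cmp i j
... | tri< i<j _   _   = trans (<ᵇ-true i<j) (cong not (sym (<ᵇ-false (ℕ.<⇒≤ i<j))))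
... | tri≈ _   i≡j _   = contradiction i≡j i≢j
... | tri> _   _   j<i = trans (<ᵇ-false (ℕ.<⇒≤ j<i)) (cong not (sym (<ᵇ-true j<i)))

alternatingArc : Fin n → Fin n → Bool
alternatingArc i j = (toℕ i <ᵇ toℕ j) xor (even i xor even j)

-- The transitive tournament conjugated by the signs 1, -1, 1, …, so that its row sums are bounded.
alternating : ∀ n → Tournament n
alternating n = record { arc = alternatingArc ; irrefl = alternatingArc-irrefl ; total = alternatingArc-total }
  where
  alternatingArc-irrefl : ∀ i → alternatingArc i i ≡ false
  alternatingArc-irrefl i = cong₂ _xor_ (<ᵇ-false (ℕ.≤-refl {toℕ i})) (xor-same (even i))
  alternatingArc-total : ∀ i j → i ≢ j → alternatingArc i j ≡ not (alternatingArc j i)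
  alternatingArc-total i j i≢j = trans (cong (_xor (even i xor even j)) (<ᵇ-swap i≢j))
    (solve 3 (λ b e e′ → (con true :+ b) :+ (e :+ e′) := con true :+ (b :+ (e′ :+ e))) refl
      (toℕ j <ᵇ toℕ i) (even i) (even j))
    where open xor-∧-Solver

<ᵇ-cancelˡ-+ : ∀ n {x y} → (n ℕ.+ x <ᵇ n ℕ.+ y) ≡ (x <ᵇ y)
<ᵇ-cancelˡ-+ zero    = refl
<ᵇ-cancelˡ-+ (suc n) = <ᵇ-cancelˡ-+ n

module _ (n : ℕ) where

  -- Orders the vertices as they are met from v on in the cycle 0, …, n - 1.
  cyclicPosition : ℕ → ℕ → ℕ
  cyclicPosition v x = if x <ᵇ v then n ℕ.+ x else x

  cyclicPosition-<ᵇ : ∀ v {x y} → x ℕ.< n → y ℕ.< n →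
    (x <ᵇ v) xor ((x <ᵇ y) xor (y <ᵇ v)) ≡ (cyclicPosition v x <ᵇ cyclicPosition v y)
  cyclicPosition-<ᵇ v {x} {y} x<n y<n with ℕ.<-≤-connex x v | ℕ.<-≤-connex y v
  ... | inj₁ x<v | inj₁ y<v rewrite <ᵇ-true x<v | <ᵇ-true y<v | <ᵇ-cancelˡ-+ n {x} {y} =
    trans (not-distribʳ-xor (x <ᵇ y) true) (xor-identityʳ (x <ᵇ y))
  ... | inj₁ x<v | inj₂ v≤y rewrite <ᵇ-true x<v | <ᵇ-false v≤y | <ᵇ-true (ℕ.<-≤-trans x<v v≤y) =
    sym (<ᵇ-false (ℕ.≤-trans (ℕ.<⇒≤ y<n) (ℕ.m≤m+n n x)))
  ... | inj₂ v≤x | inj₁ y<v rewrite <ᵇ-false v≤x | <ᵇ-true y<v | <ᵇ-false (ℕ.<⇒≤ (ℕ.<-≤-trans y<v v≤x)) =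
    sym (<ᵇ-true (ℕ.<-≤-trans x<n (ℕ.m≤m+n n y)))
  ... | inj₂ v≤x | inj₂ v≤y rewrite <ᵇ-false v≤x | <ᵇ-false v≤y = xor-identityʳ (x <ᵇ y)

  switched-alternating : ∀ (v x y : Fin n) →
    switched (alternating n) v x y ≡ (cyclicPosition (toℕ v) (toℕ x) <ᵇ cyclicPosition (toℕ v) (toℕ y))
  switched-alternating v x y = trans
    (solve 6 (λ a b c d e f → (a :+ (e :+ d)) :+ ((b :+ (e :+ f)) :+ (c :+ (f :+ d))) := a :+ (b :+ c)) refl
      (toℕ x <ᵇ toℕ v) (toℕ x <ᵇ toℕ y) (toℕ y <ᵇ toℕ v) (even v) (even x) (even y))
    (cyclicPosition-<ᵇ (toℕ v) (Fin.toℕ<n x) (Fin.toℕ<n y))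
    where open xor-∧-Solver

  switched-alternating-trans : ∀ v → Transitive (Arc (switched (alternating n) v))
  switched-alternating-trans v {x} {y} {z} x→y y→z =
    trans (switched-alternating v x z) (<ᵇ-true (ℕ.<-trans (precedes x y x→y) (precedes y z y→z)))
    where
    precedes : ∀ x y → switched (alternating n) v x y ≡ true →
      cyclicPosition (toℕ v) (toℕ x) ℕ.< cyclicPosition (toℕ v) (toℕ y)
    precedes x y x→y = ℕ.<ᵇ⇒< _ _ (Equivalence.from T-≡ (trans (sym (switched-alternating v x y)) x→y))

-- Row sums of the alternating tournament

alternatingSum : ℕ → ℤ
alternatingSum n = sum {n} (sign ∘ even)

alternatingSum-suc : ∀ n → alternatingSum (suc n) ≡ 1ℤ - alternatingSum n
alternatingSum-suc n = cong (λ S → 1ℤ + S) (begin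
  ∑ (λ i → sign (not (even i)))  ≡⟨ ∑-cong (λ i → trans (sign-not (even i)) (sym (ℤ.-1*i≡-i (sign (even i))))) ⟩
  ∑ (λ i → -1ℤ * sign (even i))  ≡⟨ *-distribˡ-∑ -1ℤ _ ⟨
  -1ℤ * alternatingSum n         ≡⟨ ℤ.-1*i≡-i (alternatingSum n) ⟩
  - alternatingSum n             ∎)
  where
  open Sums n
  open ≡-Reasoning

alternatingSum-≡0⊎≡1 : ∀ n → alternatingSum n ≡ 0ℤ ⊎ alternatingSum n ≡ 1ℤ
alternatingSum-≡0⊎≡1 zero    = inj₁ refl
alternatingSum-≡0⊎≡1 (suc n) with alternatingSum-≡0⊎≡1 n
... | inj₁ S≡0 = inj₂ (trans (alternatingSum-suc n) (cong (λ S → 1ℤ - S) S≡0))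
... | inj₂ S≡1 = inj₁ (trans (alternatingSum-suc n) (cong (λ S → 1ℤ - S) S≡1))

signs-alternating-suc : ∀ (i j : Fin n) → signs (alternating (suc n)) (suc i) (suc j) ≡ signs (alternating n) i j
signs-alternating-suc i j = cong₂ (λ a b → indicator a - indicator b) (arc-suc i j) (arc-suc j i)
  where
  arc-suc : ∀ i j → alternatingArc (suc i) (suc j) ≡ alternatingArc i j
  arc-suc i j = cong ((toℕ i <ᵇ toℕ j) xor_) (xor-annihilates-not (even i) (even j))

rowSum : ∀ (i : Fin n) → sum (signs (alternating n) i) ≡ sign (even i) * (alternatingSum n - 1ℤ)
rowSum {suc n} zero    = begin
  0ℤ + ∑ (λ j → signs (alternating (suc n)) zero (suc j))
    ≡⟨ cong (λ S → 0ℤ + S) (∑-cong λ j →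
         trans (signs-≢ (alternating (suc n)) {zero} {suc j} λ ()) (cong sign (not-involutive _))) ⟩
  0ℤ + ∑ (λ j → sign (not (even j)))
    ≡⟨ cancel (∑ λ j → sign (not (even j))) ⟩
  1ℤ * (alternatingSum (suc n) - 1ℤ) ∎
  where
  open Sums n
  open ≡-Reasoning
  cancel : ∀ s → 0ℤ + s ≡ 1ℤ * (1ℤ + s - 1ℤ)
  cancel = solve-∀
rowSum {suc n} (suc i) = begin
  signs (alternating (suc n)) (suc i) zero + ∑ (λ j → signs (alternating (suc n)) (suc i) (suc j))
    ≡⟨ cong₂ _+_ (trans (signs-≢ (alternating (suc n)) {suc i} {zero} λ ()) (cong sign not-xor-true))
         (trans (∑-cong (signs-alternating-suc i)) (rowSum i)) ⟩
  sign (even i) + sign (even i) * (S - 1ℤ)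
    ≡⟨ regroup (sign (even i)) S ⟩
  - sign (even i) * (1ℤ - S - 1ℤ)
    ≡⟨ cong₂ (λ s S′ → s * (S′ - 1ℤ)) (sign-not (even i)) (alternatingSum-suc n) ⟨
  sign (even (suc i)) * (alternatingSum (suc n) - 1ℤ) ∎
  where
  open Sums n
  open ≡-Reasoning
  S : ℤ
  S = alternatingSum n
  not-xor-true : not (even i) xor true ≡ even i
  not-xor-true = trans (xor-comm (not (even i)) true) (not-involutive (even i))
  regroup : ∀ s S → s + s * (S - 1ℤ) ≡ - s * (1ℤ - S - 1ℤ)
  regroup = solve-∀

∣rowSum∣≤1 : ∀ (i : Fin n) → ∣ sum (signs (alternating n) i) ∣ ℕ.≤ 1
∣rowSum∣≤1 {n} i rewrite rowSum i with even i | alternatingSum-≡0⊎≡1 n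
... | true  | inj₁ S≡0 rewrite S≡0 = ℕ.≤-refl
... | true  | inj₂ S≡1 rewrite S≡1 = ℕ.z≤n
... | false | inj₁ S≡0 rewrite S≡0 = ℕ.≤-refl
... | false | inj₂ S≡1 rewrite S≡1 = ℕ.z≤n

module _ {n : ℕ} where
  open Sums n
  open Matrices n
  open SkewMatrices n

  ∣apply∣-≤ : ∀ {K f c} → (∀ x y → ∣ K x y ∣ ℕ.≤ 1) → (∀ x → ∣ f x ∣ ℕ.≤ c) → ∀ x → ∣ apply K f x ∣ ℕ.≤ n ℕ.* c
  ∣apply∣-≤ {K} {f} {c} ∣K∣≤1 ∣f∣≤c x = ∣∑∣-≤ {f = λ y → K x y * f y} λ y → begin
    ∣ K x y * f y ∣        ≡⟨ ℤ.abs-* (K x y) (f y) ⟩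
    ∣ K x y ∣ ℕ.* ∣ f y ∣  ≤⟨ ℕ.*-mono-≤ (∣K∣≤1 x y) (∣f∣≤c y) ⟩
    1 ℕ.* c                ≡⟨ ℕ.*-identityˡ c ⟩
    c                      ∎
    where open ℕ.≤-Reasoning

  norm²-≤ : ∀ {f c} → (∀ x → ∣ f x ∣ ℕ.≤ c) → norm² f ≤ + (n ℕ.* (c ℕ.* c))
  norm²-≤ {f} {c} ∣f∣≤c = ℤ.≤-trans (i≤+∣i∣ (norm² f)) (+≤+ (∣∑∣-≤ {f = λ x → f x * f x} λ x →
    ℕ.≤-trans (ℕ.≤-reflexive (ℤ.abs-* (f x) (f x))) (ℕ.*-mono-≤ (∣f∣≤c x) (∣f∣≤c x))))

  module _ (K : Matrix) (∣K∣≤1 : ∀ x y → ∣ K x y ∣ ℕ.≤ 1) (∣∑K∣≤1 : ∀ x → ∣ ∑ (K x) ∣ ℕ.≤ 1) where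
    open TraceExpansion K using (Kᵏu)

    ∣Kᵏu∣-≤ : ∀ i x → ∣ Kᵏu (suc i) x ∣ ℕ.≤ n ℕ.^ i
    ∣Kᵏu∣-≤ zero    x = subst (λ S → ∣ S ∣ ℕ.≤ 1) (∑-cong λ y → sym (ℤ.*-identityʳ (K x y))) (∣∑K∣≤1 x)
    ∣Kᵏu∣-≤ (suc i) x = ∣apply∣-≤ {K} {Kᵏu (suc i)} ∣K∣≤1 (∣Kᵏu∣-≤ i) x

    norm²-Kᵏu-≤ : ∀ i → norm² (Kᵏu (suc i)) ≤ (+ n) ^ suc (i ℕ.+ i)
    norm²-Kᵏu-≤ i = begin
      norm² (Kᵏu (suc i))              ≤⟨ norm²-≤ {Kᵏu (suc i)} (∣Kᵏu∣-≤ i) ⟩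
      + (n ℕ.* (n ℕ.^ i ℕ.* n ℕ.^ i))  ≡⟨ cong (λ p → + (n ℕ.* p)) (ℕ.^-distribˡ-+-* n i i) ⟨
      + (n ℕ.^ suc (i ℕ.+ i))          ≡⟨ pos-^ n (suc (i ℕ.+ i)) ⟩
      (+ n) ^ suc (i ℕ.+ i)            ∎
      where open ℤ.≤-Reasoning

    deficit₄-≤ : deficit₄ (+ n) (norm² (Kᵏu 1)) ≤ + 4 * (+ n) ^ 3
    deficit₄-≤ = begin
      + 4 * + n * norm² (Kᵏu 1)  ≤⟨ *-mono-≤-nonNeg 0≤4n (pos-^-nonNeg n 1) ℤ.≤-refl (norm²-Kᵏu-≤ 0) ⟩
      + 4 * + n * (+ n) ^ 1      ≡⟨ ℤ.*-assoc (+ 4) (+ n) ((+ n) ^ 1) ⟩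
      + 4 * (+ n) ^ 2            ≤⟨ ℤ.*-monoˡ-≤-nonNeg (+ 4) (pos-^-mono-≤ n (ℕ.n≤1+n 2)) ⟩
      + 4 * (+ n) ^ 3            ∎
      where
      open ℤ.≤-Reasoning
      0≤4n : 0ℤ ≤ + 4 * + n
      0≤4n = *-nonNeg {+ 4} {+ n} (+≤+ ℕ.z≤n) (+≤+ ℕ.z≤n)

    deficit₈-≤ : deficit₈ (+ n) (norm² (Kᵏu 1)) (norm² (Kᵏu 2)) (norm² (Kᵏu 3)) ≤ + 24 * (+ n) ^ 7
    deficit₈-≤ = begin
      + 8 * N ^ 5 * p + + 8 * N * r + + 8 * (p * q) - (+ 8 * N ^ 3 * q + + 12 * N ^ 2 * (p * p))
        ≤⟨ ℤ.i-j≤i _ _ {{ℤ.nonNegative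
             (ℤ.+-mono-≤ (*-nonNeg (c*N^k-nonNeg 8 3) 0≤q) (*-nonNeg (c*N^k-nonNeg 12 2) (0≤i² p)))}} ⟩
      + 8 * N ^ 5 * p + + 8 * N * r + + 8 * (p * q)
        ≤⟨ ℤ.+-mono-≤ (ℤ.+-mono-≤
             (*-mono-≤-nonNeg (c*N^k-nonNeg 8 5) (pos-^-nonNeg n 1) ℤ.≤-refl (norm²-Kᵏu-≤ 0))
             (*-mono-≤-nonNeg 0≤8N (pos-^-nonNeg n 5) ℤ.≤-refl (norm²-Kᵏu-≤ 2)))
             (ℤ.*-monoˡ-≤-nonNeg (+ 8) (*-mono-≤-nonNeg 0≤p (pos-^-nonNeg n 3) (norm²-Kᵏu-≤ 0) (norm²-Kᵏu-≤ 1))) ⟩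
      + 8 * N ^ 5 * N ^ 1 + + 8 * N * N ^ 5 + + 8 * (N ^ 1 * N ^ 3)
        ≡⟨ collect N ⟩
      + 16 * N ^ 6 + + 8 * N ^ 4
        ≤⟨ ℤ.+-mono-≤ (ℤ.*-monoˡ-≤-nonNeg (+ 16) (pos-^-mono-≤ n (ℕ.n≤1+n 6)))
                      (ℤ.*-monoˡ-≤-nonNeg (+ 8) (pos-^-mono-≤ n (ℕ.m≤m+n 4 3))) ⟩
      + 16 * N ^ 7 + + 8 * N ^ 7
        ≡⟨ ℤ.*-distribʳ-+ (N ^ 7) (+ 16) (+ 8) ⟨
      + 24 * N ^ 7 ∎
      where
      open ℤ.≤-Reasoning
      N p q r : ℤ
      N = + n
      p = norm² (Kᵏu 1)
      q = norm² (Kᵏu 2)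
      r = norm² (Kᵏu 3)
      0≤p : 0ℤ ≤ p
      0≤p = norm²-nonNeg (Kᵏu 1)
      0≤q : 0ℤ ≤ q
      0≤q = norm²-nonNeg (Kᵏu 2)
      0≤8N : 0ℤ ≤ + 8 * N
      0≤8N = *-nonNeg {+ 8} {N} (+≤+ ℕ.z≤n) (+≤+ ℕ.z≤n)
      c*N^k-nonNeg : ∀ c k → 0ℤ ≤ + c * N ^ k
      c*N^k-nonNeg c k = *-nonNeg {+ c} (+≤+ ℕ.z≤n) (pos-^-nonNeg n k)
      collect : ∀ n → + 8 * n ^ 5 * n ^ 1 + + 8 * n * n ^ 5 + + 8 * (n ^ 1 * n ^ 3) ≡ + 16 * n ^ 6 + + 8 * n ^ 4
      collect = solve 1 (λ n →
        con (+ 8) :* n :^ 5 :* n :^ 1 :+ con (+ 8) :* n :* n :^ 5 :+ con (+ 8) :* (n :^ 1 :* n :^ 3)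
        := con (+ 16) :* n :^ 6 :+ con (+ 8) :* n :^ 4) refl
        where open +-*-Solver

-- Comparison of functions up to O(sizeʲ)

module Asymptotics {I : Set} (size : I → ℕ) (j : ℕ) where

  infix 4 _≼_
  _≼_ : (I → ℤ) → (I → ℤ) → Set
  f ≼ g = ∃ λ D → ∀ i → f i ≤ g i + + D * (+ size i) ^ j

  ≤⇒≼ : ∀ {f g} → (∀ i → f i ≤ g i) → f ≼ g
  ≤⇒≼ {g = g} f≤g = 0 , λ i → ℤ.≤-trans (f≤g i) (ℤ.≤-reflexive (sym (ℤ.+-identityʳ (g i))))

  ≼-trans : ∀ {f g h} → f ≼ g → g ≼ h → f ≼ h
  ≼-trans {f} {g} {h} (D , f≼g) (E , g≼h) = E ℕ.+ D , λ i → let q = (+ size i) ^ j in begin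
    f i                        ≤⟨ f≼g i ⟩
    g i + + D * q              ≤⟨ ℤ.+-monoˡ-≤ (+ D * q) (g≼h i) ⟩
    h i + + E * q + + D * q    ≡⟨ ℤ.+-assoc (h i) (+ E * q) (+ D * q) ⟩
    h i + (+ E * q + + D * q)  ≡⟨ cong (λ S → h i + S) (ℤ.*-distribʳ-+ q (+ E) (+ D)) ⟨
    h i + + (E ℕ.+ D) * q      ∎
    where open ℤ.≤-Reasoning

  ≼-preorder : Preorder _ _ _
  ≼-preorder = record
    { Carrier    = I → ℤ
    ; _≈_        = _≗_
    ; _≲_        = _≼_
    ; isPreorder = record
      { isEquivalence = record
        { refl = λ _ → refl ; sym = λ f≗g i → sym (f≗g i) ; trans = λ f≗g g≗h i → trans (f≗g i) (g≗h i) }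
      ; reflexive     = λ {f} {g} f≗g → ≤⇒≼ {f} {g} (ℤ.≤-reflexive ∘ f≗g)
      ; trans         = λ {f} {g} {h} → ≼-trans {f} {g} {h}
      }
    }

  +-monoʳ-≼ : ∀ (f : I → ℤ) {g h} → g ≼ h → (λ i → f i + g i) ≼ (λ i → f i + h i)
  +-monoʳ-≼ f {g} {h} (D , g≼h) = D , λ i →
    ℤ.≤-trans (ℤ.+-monoʳ-≤ (f i) (g≼h i)) (ℤ.≤-reflexive (sym (ℤ.+-assoc (f i) (h i) _)))

  *-monoˡ-≼ : ∀ c {f g} → f ≼ g → (λ i → + c * f i) ≼ (λ i → + c * g i)
  *-monoˡ-≼ c {f} {g} (D , f≼g) = c ℕ.* D , λ i → let q = (+ size i) ^ j in begin
    + c * f i                    ≤⟨ ℤ.*-monoˡ-≤-nonNeg (+ c) (f≼g i) ⟩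
    + c * (g i + + D * q)        ≡⟨ ℤ.*-distribˡ-+ (+ c) (g i) (+ D * q) ⟩
    + c * g i + + c * (+ D * q)  ≡⟨ cong (λ S → + c * g i + S) (ℤ.*-assoc (+ c) (+ D) q) ⟨
    + c * g i + + c * + D * q    ≡⟨ cong (λ S → + c * g i + S * q) (ℤ.pos-* c D) ⟨
    + c * g i + + (c ℕ.* D) * q  ∎
    where open ℤ.≤-Reasoning

  ≼⇒∣-∣-≤ : ∀ {f g} → f ≼ g → g ≼ f → ∃ λ D → ∀ i → ∣ f i - g i ∣ ℕ.≤ D ℕ.* size i ℕ.^ j
  ≼⇒∣-∣-≤ {f} {g} (D , f≼g) (E , g≼f) = D ℕ.⊔ E , λ i → ∣i-j∣-≤
    (ℤ.≤-trans (f≼g i) (ℤ.+-monoʳ-≤ (g i) (enlarge i (ℕ.m≤m⊔n D E))))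
    (ℤ.≤-trans (g≼f i) (ℤ.+-monoʳ-≤ (f i) (enlarge i (ℕ.m≤n⊔m D E))))
    where
    enlarge : ∀ i {D D′} → D ℕ.≤ D′ → + D * (+ size i) ^ j ≤ + (D′ ℕ.* size i ℕ.^ j)
    enlarge i {D} {D′} D≤D′ = begin
      + D * (+ size i) ^ j     ≡⟨ pos-*-^ D (size i) j ⟨
      + (D ℕ.* size i ℕ.^ j)   ≤⟨ +≤+ (ℕ.*-monoˡ-≤ (size i ℕ.^ j) D≤D′) ⟩
      + (D′ ℕ.* size i ℕ.^ j)  ∎
      where open ℤ.≤-Reasoning

-- Falling factorials

k!*nCk≡nP′k : ∀ {n k} → k ℕ.≤ n → k ! ℕ.* (n C k) ≡ n P′ k
k!*nCk≡nP′k {n} {k} k≤n = begin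
  k ! ℕ.* (n C k)              ≡⟨ cong (k ! ℕ.*_) (nCk≡nPk/k! k≤n) ⟩
  k ! ℕ.* ((n ℕ.P k) ℕ./ k !)  ≡⟨ cong (λ p → k ! ℕ.* (p ℕ./ k !)) nPk≡nP′k ⟩
  k ! ℕ.* ((n P′ k) ℕ./ k !)   ≡⟨ ℕ.m*[n/m]≡n (k!∣nP′k k≤n) ⟩
  n P′ k                       ∎
  where
  open ≡-Reasoning
  instance _ = k ℕ.!≢0
  nPk≡nP′k : n ℕ.P k ≡ n P′ k
  nPk≡nP′k = trans (nPk≡n!/[n∸k]! k≤n) (sym (nP′k≡n!/[n∸k]! k≤n))

nP′k≤n^k : ∀ n k → n P′ k ℕ.≤ n ℕ.^ k
nP′k≤n^k n zero    = ℕ.≤-refl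
nP′k≤n^k n (suc k) = ℕ.*-mono-≤ (ℕ.m∸n≤m n k) (nP′k≤n^k n k)

n^k≤nP′k+ : ∀ n k → n ℕ.^ suc k ℕ.≤ n P′ suc k ℕ.+ triangular (suc k) ℕ.* n ℕ.^ k
n^k≤nP′k+ n zero    = ℕ.m≤m+n (n ℕ.* 1) 0
n^k≤nP′k+ n (suc k) = begin
  n ℕ.* n ℕ.^ suc k
    ≤⟨ ℕ.*-monoʳ-≤ n (n^k≤nP′k+ n k) ⟩
  n ℕ.* (p ℕ.+ t ℕ.* n ℕ.^ k)
    ≡⟨ split n p t (n ℕ.^ k) ⟩
  n ℕ.* p ℕ.+ t ℕ.* n ℕ.^ suc k
    ≤⟨ ℕ.+-monoˡ-≤ _ (ℕ.*-monoˡ-≤ p (ℕ.m≤n+m∸n n (suc k))) ⟩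
  (suc k ℕ.+ (n ℕ.∸ suc k)) ℕ.* p ℕ.+ t ℕ.* n ℕ.^ suc k
    ≡⟨ expand (suc k) (n ℕ.∸ suc k) p (t ℕ.* n ℕ.^ suc k) ⟩
  n P′ suc (suc k) ℕ.+ (suc k ℕ.* p ℕ.+ t ℕ.* n ℕ.^ suc k)
    ≤⟨ ℕ.+-monoʳ-≤ (n P′ suc (suc k)) (ℕ.+-monoˡ-≤ _ (ℕ.*-monoʳ-≤ (suc k) (nP′k≤n^k n (suc k)))) ⟩
  n P′ suc (suc k) ℕ.+ (suc k ℕ.* n ℕ.^ suc k ℕ.+ t ℕ.* n ℕ.^ suc k)
    ≡⟨ cong ((n P′ suc (suc k)) ℕ.+_) (ℕ.*-distribʳ-+ (n ℕ.^ suc k) (suc k) t) ⟨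
  n P′ suc (suc k) ℕ.+ triangular (suc (suc k)) ℕ.* n ℕ.^ suc k ∎
  where
  open ℕ.≤-Reasoning
  p t : ℕ
  p = n P′ suc k
  t = triangular (suc k)
  split : ∀ n p t q → n ℕ.* (p ℕ.+ t ℕ.* q) ≡ n ℕ.* p ℕ.+ t ℕ.* (n ℕ.* q)
  split = ℕ.solve-∀
  expand : ∀ k m p r → (k ℕ.+ m) ℕ.* p ℕ.+ r ≡ m ℕ.* p ℕ.+ (k ℕ.* p ℕ.+ r)
  expand = ℕ.solve-∀

-- The limit

cross-multiply-< : ∀ {d u F K} M e .{{_ : NonZero M}} .{{_ : NonZero e}} → d ℕ.* u ℕ.< F ℕ.* K →
  u ℕ.* (d ℕ.* M) ℕ.< e ℕ.* K ℕ.* (1 ℕ.* (F ℕ.* M))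
cross-multiply-< {d} {u} {F} {K} M e du<FK = begin-strict
  u ℕ.* (d ℕ.* M)                ≡⟨ exchange u d M ⟩
  d ℕ.* u ℕ.* M                  <⟨ ℕ.*-monoˡ-< M du<FK ⟩
  F ℕ.* K ℕ.* M                  ≤⟨ ℕ.m≤n*m (F ℕ.* K ℕ.* M) e ⟩
  e ℕ.* (F ℕ.* K ℕ.* M)          ≡⟨ interchange e F K M ⟩
  e ℕ.* K ℕ.* (1 ℕ.* (F ℕ.* M))  ∎
  where
  open ℕ.≤-Reasoning
  exchange : ∀ u d m → u ℕ.* (d ℕ.* m) ≡ d ℕ.* u ℕ.* m
  exchange = ℕ.solve-∀
  interchange : ∀ e f k m → e ℕ.* (f ℕ.* k ℕ.* m) ≡ e ℕ.* k ℕ.* (1 ℕ.* (f ℕ.* m))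
  interchange = ℕ.solve-∀

∣∣<-cleared : ∀ c K M F a .{{_ : NonZero M}} .{{_ : NonZero F}} ε → 0ℚ ℚ.< ε →
  ℚ.↧ₙ ε ℕ.* ∣ + F * (+ M * + c) - + a * + K ∣ ℕ.< F ℕ.* K →
  ℚ.∣ + c / 1 ℚ.- + a / F ℚ.* (+ K / M) ∣ ℚ.< ε ℚ.* (+ K / M)
∣∣<-cleared c K M F a (mkℚ (+ 0) _ _)    (ℚ.*<* (ℤ.+<+ ())) _
∣∣<-cleared c K M F a (mkℚ -[1+ _ ] _ _) (ℚ.*<* ())         _
∣∣<-cleared c K M@(suc M-1) F@(suc F-1) a ε@(mkℚ +[1+ e-1 ] d-1 _) _ du<FK = ℚ.toℚᵘ-cancel-< (begin-strict
  toℚᵘ ℚ.∣ x ℚ.- y ℚ.* z ∣     ≃⟨ ℚ.toℚᵘ-homo-∣-∣ (x ℚ.- y ℚ.* z) ⟩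
  ℚᵘ.∣ toℚᵘ (x ℚ.- y ℚ.* z) ∣  ≃⟨ ℚᵘ.∣-∣-cong unnormalise ⟩
  ℚᵘ.∣ xᵘ ℚᵘ.- yᵘ ℚᵘ.* zᵘ ∣    <⟨ ℚᵘ.*<* cross-multiplied ⟩
  toℚᵘ ε ℚᵘ.* zᵘ               ≃⟨ ℚᵘ.*-congˡ {toℚᵘ ε} (ℚ.toℚᵘ-fromℚᵘ zᵘ) ⟨
  toℚᵘ ε ℚᵘ.* toℚᵘ z           ≃⟨ ℚ.toℚᵘ-homo-* ε z ⟨
  toℚᵘ (ε ℚ.* z)               ∎)
  where
  open ℚᵘ.≤-Reasoning
  x y z : ℚ
  x = + c / 1
  y = + a / F
  z = + K / M
  xᵘ yᵘ zᵘ : ℚᵘ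
  xᵘ = mkℚᵘ (+ c) 0
  yᵘ = mkℚᵘ (+ a) F-1
  zᵘ = mkℚᵘ (+ K) M-1
  unnormalise : toℚᵘ (x ℚ.- y ℚ.* z) ℚᵘ.≃ xᵘ ℚᵘ.- yᵘ ℚᵘ.* zᵘ
  unnormalise = ℚᵘ.≃-trans (ℚ.toℚᵘ-homo-+ x (ℚ.- (y ℚ.* z)))
    (ℚᵘ.+-cong (ℚ.toℚᵘ-fromℚᵘ xᵘ) (ℚᵘ.≃-trans (ℚ.toℚᵘ-homo‿- (y ℚ.* z))
      (ℚᵘ.-‿cong (ℚᵘ.≃-trans (ℚ.toℚᵘ-homo-* y z) (ℚᵘ.*-cong (ℚ.toℚᵘ-fromℚᵘ yᵘ) (ℚ.toℚᵘ-fromℚᵘ zᵘ))))))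
  d e u : ℕ
  d = suc d-1
  e = suc e-1
  u = ∣ + F * (+ M * + c) - + a * + K ∣
  numerators : + c * + (F ℕ.* M) + (- (+ a * + K)) * 1ℤ ≡ + F * (+ M * + c) - + a * + K
  numerators = trans (cong (λ p → + c * p + (- (+ a * + K)) * 1ℤ) (ℤ.pos-* F M)) (regroup (+ c) (+ F) (+ M) (+ a * + K))
    where
    regroup : ∀ c f m k → c * (f * m) + (- k) * 1ℤ ≡ f * (m * c) - k
    regroup = solve-∀
  cross-multiplied : + ∣ + c * + (F ℕ.* M) + (- (+ a * + K)) * 1ℤ ∣ * + (d ℕ.* M) ℤ.< + e * + K * + (1 ℕ.* (F ℕ.* M))
  cross-multiplied = subst₂ ℤ._<_
    (trans (ℤ.pos-* u (d ℕ.* M)) (cong (λ i → + ∣ i ∣ * + (d ℕ.* M)) (sym numerators)))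
    (trans (ℤ.pos-* (e ℕ.* K) _) (cong (_* + (1 ℕ.* (F ℕ.* M))) (ℤ.pos-* e K)))
    (ℤ.+<+ (cross-multiply-< {d} {u} {F} M e du<FK))

module _ (j : ℕ) where
  private
    ℓ : ℕ
    ℓ = suc j

  -- These say that 2ˡ cycleSeqs T ℓ is, up to O(nʲ), at most a/F nˡ for all T and at least a/F nˡ for the given ones.
  CycleSeqsAtMost : ℕ → ℕ → Set
  CycleSeqsAtMost F a = (λ (n , T) → + F * (+ (2 ℕ.^ ℓ) * + cycleSeqs T ℓ)) ≼ (λ (n , _) → + a * (+ n) ^ ℓ)
    where open Asymptotics {∃ Tournament} proj₁ j

  CycleSeqsAtLeast : ℕ → ℕ → (∀ n → Tournament n) → Set
  CycleSeqsAtLeast F a T = (λ n → + a * (+ n) ^ ℓ) ≼ (λ n → + F * (+ (2 ℕ.^ ℓ) * + cycleSeqs (T n) ℓ))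
    where open Asymptotics {ℕ} id j

  open Asymptotics {∃ (ℓ ℕ.≤_)} proj₁ j

  ^≼P′ : (λ (n , _) → (+ n) ^ ℓ) ≼ (λ (n , _) → + (n P′ ℓ))
  ^≼P′ = triangular ℓ , λ (n , _) → begin
    (+ n) ^ ℓ                                  ≡⟨ pos-^ n ℓ ⟨
    + (n ℕ.^ ℓ)                                ≤⟨ +≤+ (n^k≤nP′k+ n j) ⟩
    + (n P′ ℓ) + + (triangular ℓ ℕ.* n ℕ.^ j)  ≡⟨ cong (λ S → + (n P′ ℓ) + S) (pos-*-^ (triangular ℓ) n j) ⟩
    + (n P′ ℓ) + + triangular ℓ * (+ n) ^ j    ∎
    where open ℤ.≤-Reasoning

  module _ (F a : ℕ) .{{_ : NonZero F}} (Cℓ : ℕ → ℕ) (isMax : ∀ n → ℓ ℕ.≤ n → IsMaxCycles n ℓ (Cℓ n)) where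
    private
      M : ℕ
      M = 2 ℕ.^ ℓ

    maximal : ∀ {n} → ℓ ℕ.≤ n → Tournament n
    maximal ℓ≤n = proj₁ (proj₁ (isMax _ ℓ≤n))

    Cℓ*ℓ≤cycleSeqs-maximal : ∀ {n} (ℓ≤n : ℓ ℕ.≤ n) → Cℓ n ℕ.* ℓ ℕ.≤ cycleSeqs (maximal ℓ≤n) ℓ
    Cℓ*ℓ≤cycleSeqs-maximal {n} ℓ≤n = subst (λ m → m ℕ.* ℓ ℕ.≤ cycleSeqs (maximal ℓ≤n) ℓ) (proj₂ (proj₁ (isMax n ℓ≤n)))
      (ℕ.m/n*n≤m (cycleSeqs (maximal ℓ≤n) ℓ) ℓ)

    cycleSeqs≼Cℓ*ℓ : (T : ∀ n → Tournament n) → (λ (n , _) → + cycleSeqs (T n) ℓ) ≼ (λ (n , _) → + (Cℓ n ℕ.* ℓ))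
    cycleSeqs≼Cℓ*ℓ T = ℓ , λ (n , ℓ≤n) → let c = cycleSeqs (T n) ℓ in begin
      + c                                 ≡⟨ cong +_ (trans (ℕ.m≡m%n+[m/n]*n c ℓ) (ℕ.+-comm (c ℕ.% ℓ) _)) ⟩
      + (c ℕ./ ℓ ℕ.* ℓ ℕ.+ c ℕ.% ℓ)       ≤⟨ +≤+ (ℕ.+-mono-≤ (ℕ.*-monoˡ-≤ ℓ (proj₂ (isMax n ℓ≤n) (T n)))
                                               (ℕ.≤-trans (ℕ.<⇒≤ (ℕ.m%n<n c ℓ)) (ℕ.m≤m*n ℓ (n ℕ.^ j) {{n^j≢0 ℓ≤n}}))) ⟩
      + (Cℓ n ℕ.* ℓ) + + (ℓ ℕ.* n ℕ.^ j)  ≡⟨ cong (λ S → + (Cℓ n ℕ.* ℓ) + S) (pos-*-^ ℓ n j) ⟩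
      + (Cℓ n ℕ.* ℓ) + + ℓ * (+ n) ^ j    ∎
      where
      open ℤ.≤-Reasoning
      n^j≢0 : ∀ {n} → ℓ ℕ.≤ n → NonZero (n ℕ.^ j)
      n^j≢0 {suc n} _ = ℕ.m^n≢0 (suc n) j

    scaledMax scaledMean : ∃ (ℓ ℕ.≤_) → ℤ
    scaledMax  (n , _) = + F * (+ M * + (Cℓ n ℕ.* ℓ))
    scaledMean (n , _) = + a * + (n P′ ℓ)

    scaledMax≼scaledMean : CycleSeqsAtMost F a → scaledMax ≼ scaledMean
    scaledMax≼scaledMean upper = begin
      scaledMax
        ≲⟨ *-monoˡ-≼ F (*-monoˡ-≼ M (≤⇒≼ λ (n , ℓ≤n) → +≤+ (Cℓ*ℓ≤cycleSeqs-maximal ℓ≤n))) ⟩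
      (λ (n , ℓ≤n) → + F * (+ M * + cycleSeqs (maximal ℓ≤n) ℓ))
        ≲⟨ map₂ (λ upper (n , ℓ≤n) → upper (n , maximal ℓ≤n)) upper ⟩
      (λ (n , _) → + a * (+ n) ^ ℓ)
        ≲⟨ *-monoˡ-≼ a ^≼P′ ⟩
      scaledMean ∎
      where open PreorderReasoning ≼-preorder

    scaledMean≼scaledMax : (T : ∀ n → Tournament n) → CycleSeqsAtLeast F a T → scaledMean ≼ scaledMax
    scaledMean≼scaledMax T lower = begin
      scaledMean
        ≲⟨ *-monoˡ-≼ a (≤⇒≼ λ (n , _) → subst (+ (n P′ ℓ) ≤_) (pos-^ n ℓ) (+≤+ (nP′k≤n^k n ℓ))) ⟩
      (λ (n , _) → + a * (+ n) ^ ℓ)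
        ≲⟨ map₂ (λ lower (n , _) → lower n) lower ⟩
      (λ (n , _) → + F * (+ M * + cycleSeqs (T n) ℓ))
        ≲⟨ *-monoˡ-≼ F (*-monoˡ-≼ M (cycleSeqs≼Cℓ*ℓ T)) ⟩
      scaledMax ∎
      where open PreorderReasoning ≼-preorder

    module _ {D n : ℕ} (ℓ≤n : ℓ ℕ.≤ n)
      (close : ∣ scaledMax (n , ℓ≤n) - scaledMean (n , ℓ≤n) ∣ ℕ.≤ D ℕ.* n ℕ.^ j) where
      private
        K u : ℕ
        K = j ! ℕ.* (n C ℓ)
        u = ∣ + F * (+ M * + Cℓ n) - + a * + K ∣

      K*ℓ≡nP′ℓ : K ℕ.* ℓ ≡ n P′ ℓ
      K*ℓ≡nP′ℓ = trans (regroup (j !) (n C ℓ) ℓ) (k!*nCk≡nP′k ℓ≤n)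
        where
        regroup : ∀ f c l → f ℕ.* c ℕ.* l ≡ l ℕ.* f ℕ.* c
        regroup = ℕ.solve-∀

      u*ℓ≡∣max-mean∣ : u ℕ.* ℓ ≡ ∣ scaledMax (n , ℓ≤n) - scaledMean (n , ℓ≤n) ∣
      u*ℓ≡∣max-mean∣ = trans (sym (ℤ.abs-* (+ F * (+ M * + Cℓ n) - + a * + K) (+ ℓ))) (cong ∣_∣ (begin
        (+ F * (+ M * + Cℓ n) - + a * + K) * + ℓ
          ≡⟨ distrib (+ F) (+ M) (+ Cℓ n) (+ a) (+ K) (+ ℓ) ⟩
        + F * (+ M * (+ Cℓ n * + ℓ)) - + a * (+ K * + ℓ)
          ≡⟨ cong₂ (λ x y → + F * (+ M * x) - + a * y) (ℤ.pos-* (Cℓ n) ℓ) (ℤ.pos-* K ℓ) ⟨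
        + F * (+ M * + (Cℓ n ℕ.* ℓ)) - + a * + (K ℕ.* ℓ)
          ≡⟨ cong (λ y → + F * (+ M * + (Cℓ n ℕ.* ℓ)) - + a * + y) K*ℓ≡nP′ℓ ⟩
        + F * (+ M * + (Cℓ n ℕ.* ℓ)) - + a * + (n P′ ℓ) ∎))
        where
        open ≡-Reasoning
        distrib : ∀ f m c a k l → (f * (m * c) - a * k) * l ≡ f * (m * (c * l)) - a * (k * l)
        distrib = solve-∀

      ratio-close : ∀ ε → 0ℚ ℚ.< ε → triangular ℓ ℕ.+ ℚ.↧ₙ ε ℕ.* D ℕ.< n →
        ℚ.∣ + Cℓ n / 1 ℚ.- + a / F ℚ.* R n ℓ ∣ ℚ.< ε ℚ.* R n ℓ
      ratio-close ε 0<ε large = ∣∣<-cleared (Cℓ n) K M F a {{ℕ.m^n≢0 2 ℓ}} ε 0<ε (ℕ.*-cancelʳ-< ℓ _ _ (begin-strict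
        d ℕ.* u ℕ.* ℓ          ≡⟨ ℕ.*-assoc d u ℓ ⟩
        d ℕ.* (u ℕ.* ℓ)        ≤⟨ ℕ.*-monoʳ-≤ d (ℕ.≤-trans (ℕ.≤-reflexive u*ℓ≡∣max-mean∣) close) ⟩
        d ℕ.* (D ℕ.* q)        <⟨ ℕ.+-cancelˡ-< (triangular ℓ ℕ.* q) _ _ triangular+d*D*q<nP′ℓ ⟩
        n P′ ℓ                 ≤⟨ ℕ.m≤n*m (n P′ ℓ) F ⟩
        F ℕ.* (n P′ ℓ)         ≡⟨ cong (F ℕ.*_) K*ℓ≡nP′ℓ ⟨
        F ℕ.* (K ℕ.* ℓ)        ≡⟨ ℕ.*-assoc F K ℓ ⟨
        F ℕ.* K ℕ.* ℓ          ∎))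
        where
        open ℕ.≤-Reasoning
        d q : ℕ
        d = ℚ.↧ₙ ε
        q = n ℕ.^ j
        q≢0 : NonZero q
        q≢0 = ℕ.m^n≢0 n j {{ℕ.>-nonZero (ℕ.≤-<-trans ℕ.z≤n large)}}
        factor : ∀ t d D q → t ℕ.* q ℕ.+ d ℕ.* (D ℕ.* q) ≡ (t ℕ.+ d ℕ.* D) ℕ.* q
        factor = ℕ.solve-∀
        triangular+d*D*q<nP′ℓ : triangular ℓ ℕ.* q ℕ.+ d ℕ.* (D ℕ.* q) ℕ.< triangular ℓ ℕ.* q ℕ.+ n P′ ℓ
        triangular+d*D*q<nP′ℓ = begin-strict
          triangular ℓ ℕ.* q ℕ.+ d ℕ.* (D ℕ.* q)  ≡⟨ factor (triangular ℓ) d D q ⟩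
          (triangular ℓ ℕ.+ d ℕ.* D) ℕ.* q        <⟨ ℕ.*-monoˡ-< q {{q≢0}} large ⟩
          n ℕ.* q                                 ≤⟨ n^k≤nP′k+ n j ⟩
          n P′ ℓ ℕ.+ triangular ℓ ℕ.* q           ≡⟨ ℕ.+-comm (n P′ ℓ) _ ⟩
          triangular ℓ ℕ.* q ℕ.+ n P′ ℓ           ∎

  limit : ∀ F a .{{_ : NonZero F}} →
    CycleSeqsAtMost F a → (T : ∀ n → Tournament n) → CycleSeqsAtLeast F a T → LimitIs ℓ (+ a / F)
  limit F a upper T lower Cℓ isMax ε 0<ε =
    let D , close = ≼⇒∣-∣-≤ (scaledMax≼scaledMean F a Cℓ isMax upper) (scaledMean≼scaledMax F a Cℓ isMax T lower)
        b = suc (triangular ℓ ℕ.+ ℚ.↧ₙ ε ℕ.* D)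
    in ℓ ℕ.⊔ b , λ n large → let ℓ≤n = ℕ.≤-trans (ℕ.m≤m⊔n ℓ b) large in
      ratio-close F a Cℓ isMax ℓ≤n (close (n , ℓ≤n)) ε 0<ε (ℕ.≤-trans (ℕ.m≤n⊔m ℓ b) large)

-- The maximum density of cycles

module _ (k b : ℕ) where
  private
    j ℓ F : ℕ
    j = suc k
    ℓ = suc j
    F = j !

    split : ∀ n → + (F ℕ.+ b) * (+ n) ^ ℓ ≡ + F * (+ n) ^ ℓ + (+ n) ^ ℓ * + b
    split n = trans (ℤ.*-distribʳ-+ ((+ n) ^ ℓ) (+ F) (+ b))
      (cong (λ S → + F * (+ n) ^ ℓ + S) (ℤ.*-comm (+ b) ((+ n) ^ ℓ)))

    distrib : ∀ n t → + F * (t + (+ n) ^ ℓ) ≡ + F * (+ n) ^ ℓ + + F * t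
    distrib n t = trans (ℤ.*-distribˡ-+ (+ F) t ((+ n) ^ ℓ)) (ℤ.+-comm (+ F * t) _)

  module _ (deficit : ∀ {n} → Tournament n → ℤ)
    (walkTrace+deficit : ∀ {n} (T : Tournament n) → walkTrace T j + deficit T ≡ signTrace T j + (+ n) ^ ℓ) where

    cycleSeqs-upper : minSignedPaths j ≡ - + b → (∀ {n} (T : Tournament n) → 0ℤ ≤ deficit T) →
      CycleSeqsAtMost j F (F ℕ.+ b)
    cycleSeqs-upper min≡-b 0≤deficit = begin
      (λ (n , T) → + F * (+ (2 ℕ.^ ℓ) * + cycleSeqs T ℓ))
        ≲⟨ *-monoˡ-≼ F (≤⇒≼ λ (n , T) → 2^ℓ*cycleSeqs-≤-walkTrace T j) ⟩
      (λ (n , T) → + F * walkTrace T j)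
        ≲⟨ *-monoˡ-≼ F (≤⇒≼ λ (n , T) → subst (walkTrace T j ≤_) (walkTrace+deficit T)
             (ℤ.i≤i+j _ (deficit T) {{ℤ.nonNegative (0≤deficit T)}})) ⟩
      (λ (n , T) → + F * (signTrace T j + (+ n) ^ ℓ))
        ≈⟨ (λ (n , T) → distrib n (signTrace T j)) ⟩
      (λ (n , T) → + F * (+ n) ^ ℓ + + F * signTrace T j)
        ≲⟨ +-monoʳ-≼ (λ (n , T) → + F * (+ n) ^ ℓ) (F ℕ.* triangular ℓ , λ (n , T) → signTrace-≤ T k b min≡-b) ⟩
      (λ (n , T) → + F * (+ n) ^ ℓ + (+ n) ^ ℓ * + b)
        ≈⟨ (λ (n , T) → split n) ⟨
      (λ (n , T) → + (F ℕ.+ b) * (+ n) ^ ℓ) ∎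
      where
      open Asymptotics {∃ Tournament} proj₁ j
      open PreorderReasoning ≼-preorder

    cycleSeqs-lower : ∀ {d} → transitiveSignedPaths j ≡ - + b → (∀ n → deficit (alternating n) ≤ + d * (+ n) ^ j) →
      CycleSeqsAtLeast j F (F ℕ.+ b) alternating
    cycleSeqs-lower {d} transitive≡-b deficit≤ = begin
      (λ n → + (F ℕ.+ b) * (+ n) ^ ℓ)
        ≈⟨ split ⟩
      (λ n → + F * (+ n) ^ ℓ + (+ n) ^ ℓ * + b)
        ≲⟨ +-monoʳ-≼ (λ n → + F * (+ n) ^ ℓ) ((b ℕ.+ F) ℕ.* triangular ℓ , λ n →
             signTrace-≥ (alternating n) k b transitive≡-b (switched-alternating-trans n)) ⟩
      (λ n → + F * (+ n) ^ ℓ + + F * signTrace (alternating n) j)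
        ≈⟨ (λ n → distrib n (signTrace (alternating n) j)) ⟨
      (λ n → + F * (signTrace (alternating n) j + (+ n) ^ ℓ))
        ≲⟨ *-monoˡ-≼ F (d , λ n → let t = walkTrace (alternating n) j in
             subst (_≤ t + + d * (+ n) ^ j) (walkTrace+deficit (alternating n)) (ℤ.+-monoʳ-≤ t (deficit≤ n))) ⟩
      (λ n → + F * walkTrace (alternating n) j)
        ≲⟨ *-monoˡ-≼ F (2 ℕ.^ ℓ ℕ.* triangular ℓ , λ n → walkTrace-≤-2^ℓ*cycleSeqs (alternating n) k) ⟩
      (λ n → + F * (+ (2 ℕ.^ ℓ) * + cycleSeqs (alternating n) ℓ)) ∎
      where
      open Asymptotics {ℕ} id j
      open PreorderReasoning ≼-preorder

    cycleDensity : ∀ {d} → minSignedPaths j ≡ - + b → transitiveSignedPaths j ≡ - + b →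
      (∀ {n} (T : Tournament n) → 0ℤ ≤ deficit T) → (∀ n → deficit (alternating n) ≤ + d * (+ n) ^ j) →
      LimitIs ℓ (_/_ (+ (F ℕ.+ b)) F {{j ℕ.!≢0}})
    cycleDensity {d} min≡-b transitive≡-b 0≤deficit deficit≤ = limit j F (F ℕ.+ b) {{j ℕ.!≢0}}
      (cycleSeqs-upper min≡-b 0≤deficit) alternating (cycleSeqs-lower {d} transitive≡-b deficit≤)

signNorm² : Tournament n → ℕ → ℤ
signNorm² {n} T = SkewMatrices.∣Kᵏu∣² n (signs T) (signs-skew T)

theorem20 : LimitIs 4 ((+ 4) / 3) × LimitIs 8 ((+ 332) / 315)
theorem20 =
  cycleDensity 2 2
    (λ {n} T → deficit₄ (+ n) (signNorm² T 1))
    (λ {n} T → SkewMatrices.trace+deficit₄ n (signs T) (signs-skew T))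
    {4} refl refl
    (λ {n} T → SkewMatrices.deficit₄-nonNeg n (signs T) (signs-skew T))
    (λ n → deficit₄-≤ (signs (alternating n)) (∣signs∣≤1 (alternating n)) ∣rowSum∣≤1) ,
  cycleDensity 6 272
    (λ {n} T → deficit₈ (+ n) (signNorm² T 1) (signNorm² T 2) (signNorm² T 3))
    (λ {n} T → SkewMatrices.trace+deficit₈ n (signs T) (signs-skew T))
    {24} refl refl
    (λ {n} T → SkewMatrices.deficit₈-nonNeg n (signs T) (signs-skew T))
    (λ n → deficit₈-≤ (signs (alternating n)) (∣signs∣≤1 (alternating n)) ∣rowSum∣≤1)
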